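{- For each prime power $q$ with $q\equiv 2\pmod 3$, $M(q,q-3)\ge (q+1)q(q-1)$.
   Context: $M(m,d)$ denotes the maximum size of a set of permutations of an $m$-element set in which every two distinct permutations have Hamming distance at least $d$, where the Hamming distance of two permutations is the number of points at which they differ.
   Formalization: The prime power q = 2 is excluded by requiring q ≥ 4: there the claim would read M(2,-1) ≥ 6, which is false because a 2-element set has only 2 permutations; every other prime power q ≡ 2 (mod 3) is covered. -}

module Defs where

open import Data.Nat using (ℕ; zero; suc; _+_; _∸_; _^_; _≤_; _*_)
open import Data.Nat.Primality using (Prime)
open import Data.Fin using (Fin; _≟_)
open import Data.Fin.Permutation using (Permutation′; _⟨$⟩ʳ_)
open import Data.List using (List; length; filter; allFin)
open import Data.Product using (Σ; ∃; _×_)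
open import Relation.Nullary using (¬_)
open import Relation.Nullary.Decidable using (¬?)
open import Relation.Binary.PropositionalEquality using (_≡_)

IsPrimePower : ℕ → Set
IsPrimePower q = Σ ℕ λ p → Σ ℕ λ k → Prime p × 1 ≤ k × q ≡ p ^ k

hamming : ∀ {m} → Permutation′ m → Permutation′ m → ℕ
hamming {m} π σ = length (filter (λ i → ¬? ((π ⟨$⟩ʳ i) ≟ (σ ⟨$⟩ʳ i))) (allFin m))

-- A permutation code of size N on m points with minimum distance d:
-- N pairwise distinct permutations (distinct as maps, i.e. differing at
-- some point) with every two distinct ones at Hamming distance ≥ d.
PermCode : (m d N : ℕ) → Set
PermCode m d N =
  Σ (Fin N → Permutation′ m) λ C →
    ∀ i j → ¬ i ≡ j → (1 ≤ hamming (C i) (C j)) × (d ≤ hamming (C i) (C j))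

M≥ : (m d N : ℕ) → Set
M≥ m d N = PermCode m d N

{-# OPTIONS --safe #-}
-- Over the field with q elements the maps a x + b and a (x + c)³ + b with a ≠ 0 are (q + 1) q (q - 1)
-- distinct polynomials of degree at most 3, since 3 ≠ 0, so any two agree in at most 3 points.  They are
-- permutations: as q ≡ 2 mod 3, 3 divides 2 q - 1 and x ^ (2 q - 1) = x, so cubing has a power as inverse.
--
-- The field with q = p ^ k elements is found inside R = F_p[X] / (X ^ (q - 1) - 1), where y ^ q = y for
-- all y.  Such a ring is a product of fields, and the product of the X ^ pʲ - X for 0 < j < k is nonzero in
-- R by degree, hence nonzero in some field factor K.  There X has k distinct conjugates X ^ pʲ, so
-- 1, X, …, X ^ (k - 1) are independent over F_p and K has at least q elements; it has at most q because
-- all are roots of Y ^ q - Y.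
module Submission where

open import Defs
open import Algebra.Bundles using (CommutativeRing)
open import Data.Bool using (if_then_else_)
open import Data.Empty using (⊥-elim)
open import Data.Fin using (Fin; toℕ; fromℕ; fromℕ<; inject₁; inject≤; punchIn; combine; remQuot; finToFun; funToFin)
  renaming (zero to fzero; suc to fsuc)
import Data.Fin.Properties as Fin
open import Data.Fin.Permutation using (Permutation′; _⟨$⟩ʳ_; permutation)
open import Data.List using (List; []; _∷_; length; filter; allFin; lookup; map)
open import Data.List.Membership.Propositional using (_∈_)
open import Data.List.Membership.Propositional.Properties using (∈-allFin; ∈-lookup; ∈-map⁺)
open import Data.List.Properties using (length-tabulate)
open import Data.List.Relation.Unary.All as All using (All; []; _∷_)
open import Data.List.Relation.Unary.All.Properties using (all-filter)
open import Data.List.Relation.Unary.AllPairs using (_∷_)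
open import Data.List.Relation.Unary.Unique.Propositional using (Unique)
import Data.List.Relation.Unary.Unique.Propositional.Properties as Unique
open import Data.Nat as ℕ using (ℕ; zero; suc; _!; _<_; _≤_; _∸_; _%_; _/_; z≤n; s≤s; NonZero)
open import Data.Nat.Combinatorics using (_C_; k![n∸k]!∣n!; nCk≡n!/k![n-k]!; nCn≡1)
open import Data.Nat.Coprimality using (coprime-Bézout; prime⇒coprime)
open import Data.Nat.Divisibility using (_∣_; divides; ∣⇒≤; m∣m*n; m%n≡0⇒n∣m; n∣m⇒m%n≡0)
open import Data.Nat.DivMod
  using (%-distribˡ-+; %-distribˡ-*; [m+n]%n≡m%n; m*n%n≡0; m/n*n≡m; m<n⇒m%n≡m; m%n<n; m≡m%n+[m/n]*n; n%n≡0)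
open import Data.Nat.GCD using (module Bézout)
open import Data.Nat.Primality
  using (Prime; euclidsLemma; prime?; prime⇒irreducible; prime⇒nonTrivial; prime⇒nonZero; ¬prime[1])
import Data.Nat.Properties as ℕ
open import Data.Product using (∃; _,_; _×_; proj₁; proj₂)
open import Data.Sum using (_⊎_; inj₁; inj₂)
open import Function using (_∘_; id)
open import Level using (0ℓ)
open import Relation.Binary.Definitions using (Decidable; tri<; tri≈; tri>)
open import Relation.Binary.PropositionalEquality as ≡ using (_≡_)
open import Relation.Nullary using (¬_; yes; no; does)
open import Relation.Nullary.Decidable using (¬?; from-yes; map′)
open import Relation.Unary using () renaming (Decidable to Decidable₁)

-- The obstacle is to obtain the field with no irreducible polynomial of degree k at hand and no
-- appeal to maximal ideals. The identity y ^ q = y replaces both: it makes every y ^ (q - 1)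
-- idempotent, so a field factor is reached by finitely many multiplications, provided that R is
-- finite up to equality and its equality is decidable. For this reason elements of R are
-- expressions in X that act by shifts on one sequence of period q - 1, and equality is agreement on
-- that sequence, which one period decides. The product to be kept nonzero has degree p + ... + p ^
-- (k - 1), at most q - 2 and equal to it when p = 2, so it just fits below the degree of the
-- modulus.
--
-- A single root count, that values at n distinct points determine n coefficients, serves three
-- times: for the independence of the powers of X, for the upper bound on the size of K, and for the
-- distance of the code.

-- Binomial coefficients and Frobenius in characteristic p

prime∤! : ∀ {p} → Prime p → ∀ k → k < p → ¬ (p ∣ k !)
prime∤! pr zero k<p p∣1 = ℕ.<⇒≱ (ℕ.nonTrivial⇒n>1 _ {{prime⇒nonTrivial pr}}) (∣⇒≤ p∣1)
prime∤! pr (suc k) k<p p∣ with euclidsLemma (suc k) (k !) pr p∣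
... | inj₁ p∣k = ℕ.<⇒≱ k<p (∣⇒≤ p∣k)
... | inj₂ p∣k! = prime∤! pr k (ℕ.<-trans (ℕ.n<1+n k) k<p) p∣k!

-- Euclid's lemma on p! = C(p, k) (k! (p - k)!): both factorials are products of numbers below p.
prime∣C : ∀ {p k} → Prime p → 0 < k → k < p → p ∣ (p C k)
prime∣C {p@(suc _)} {k} pr 0<k k<p with euclidsLemma (p C k) (k ! ℕ.* (p ∸ k) !) pr p∣
  where
  k≤p = ℕ.<⇒≤ k<p
  instance
    _ : NonZero (k ! ℕ.* (p ∸ k) !)
    _ = ℕ.m*n≢0 (k !) ((p ∸ k) !) {{ℕ.>-nonZero (ℕ.1≤n! k)}} {{ℕ.>-nonZero (ℕ.1≤n! (p ∸ k))}}
  eq : (p C k) ℕ.* (k ! ℕ.* (p ∸ k) !) ≡ p !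
  eq = ≡.trans (≡.cong (ℕ._* (k ! ℕ.* (p ∸ k) !)) (nCk≡n!/k![n-k]! k≤p)) (m/n*n≡m (k![n∸k]!∣n! k≤p))
  p∣ : p ∣ (p C k) ℕ.* (k ! ℕ.* (p ∸ k) !)
  p∣ = ≡.subst (p ∣_) (≡.sym eq) (m∣m*n _)
... | inj₁ p∣C = p∣C
... | inj₂ p∣!! with euclidsLemma (k !) ((p ∸ k) !) pr p∣!!
... | inj₁ p∣! = ⊥-elim (prime∤! pr k k<p p∣!)
... | inj₂ p∣! = ⊥-elim (prime∤! pr (p ∸ k) (ℕ.∸-monoʳ-< 0<k (ℕ.<⇒≤ k<p)) p∣!)

KilledBy : ∀ {c ℓ} → ℕ → CommutativeRing c ℓ → Set ℓ
KilledBy n K = (n · 1#) ≈ 0#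
  where
  open CommutativeRing K
  open import Algebra.Properties.Semiring.Mult semiring using () renaming (_×_ to _·_)

module Characteristic {c ℓ} (K : CommutativeRing c ℓ) {p : ℕ} (prime : Prime p)
  (p·1≈0 : KilledBy p K) where

  open CommutativeRing K
  open import Algebra.Properties.Semiring.Mult semiring
    using (×-congʳ; ×-assocˡ; ×-assoc-*; ×-homo-1) renaming (_×_ to _·_)
  open import Algebra.Properties.CommutativeSemiring.Exp commutativeSemiring
    using (_^_; ^-congˡ; ^-assocʳ; ^-congʳ)
  open import Algebra.Properties.Semiring.Sum semiring
    using (sum; sum-cong-≋; sum-replicate-zero; sum-init-last)
  import Algebra.Properties.CommutativeSemiring.Binomial commutativeSemiring as Binomial
  open import Relation.Binary.Reasoning.Setoid setoid

  p∣⇒·≈0 : ∀ {n} → p ∣ n → ∀ x → n · x ≈ 0#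
  p∣⇒·≈0 (divides m ≡.refl) x = begin
    (m ℕ.* p) · x    ≈⟨ ×-assocˡ x m p ⟨
    m · (p · x)      ≈⟨ ×-congʳ m p·x≈0 ⟩
    m · 0#           ≈⟨ ×-congʳ m (zeroˡ 0#) ⟨
    m · (0# * 0#)    ≈⟨ ×-assoc-* m 0# 0# ⟨
    (m · 0#) * 0#    ≈⟨ zeroʳ _ ⟩
    0#               ∎
    where
    p·x≈0 : p · x ≈ 0#
    p·x≈0 = begin
      p · x          ≈⟨ ×-congʳ p (*-identityˡ x) ⟨
      p · (1# * x)   ≈⟨ ×-assoc-* p 1# x ⟨
      (p · 1#) * x   ≈⟨ *-congʳ p·1≈0 ⟩
      0# * x         ≈⟨ zeroˡ x ⟩
      0#             ∎

  frobenius-+ : ∀ x y → (x + y) ^ p ≈ x ^ p + y ^ p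
  frobenius-+ x y = lemma p ≡.refl
    where
    -- Splitting off the first and last binomial terms needs an exponent of the form `suc m`, while
    -- `p` is fixed.
    lemma : ∀ n → n ≡ p → (x + y) ^ n ≈ x ^ n + y ^ n
    lemma zero 0≡p = ⊥-elim (ℕ.<⇒≢ (ℕ.>-nonZero⁻¹ p {{prime⇒nonZero prime}}) 0≡p)
    lemma n@(suc m) n≡p = begin
      (x + y) ^ n
        ≈⟨ Binomial.theorem n x y ⟩
      term fzero + sum (term ∘ fsuc)
        ≈⟨ +-cong (trans (×-homo-1 _) (*-identityˡ _)) (sum-init-last (term ∘ fsuc)) ⟩
      y ^ n + (sum (λ i → term (fsuc (inject₁ i))) + term (fsuc (fromℕ m)))
        ≈⟨ +-congˡ (+-cong (trans (sum-cong-≋ middle≈0) (sum-replicate-zero m)) last≈) ⟩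
      y ^ n + (0# + x ^ n)
        ≈⟨ +-congˡ (+-identityˡ _) ⟩
      y ^ n + x ^ n
        ≈⟨ +-comm _ _ ⟩
      x ^ n + y ^ n ∎
      where
      term = Binomial.binomialTerm x y n
      middle≈0 : ∀ i → term (fsuc (inject₁ i)) ≈ 0#
      middle≈0 i rewrite Fin.toℕ-inject₁ i = p∣⇒·≈0
        (≡.subst (λ k → k ∣ (n C suc (toℕ i))) n≡p
          (prime∣C (≡.subst Prime (≡.sym n≡p) prime) (s≤s z≤n) (s≤s (Fin.toℕ<n i)))) _
      last≈ : term (fsuc (fromℕ m)) ≈ x ^ n
      last≈ rewrite Fin.toℕ-fromℕ m | nCn≡1 n | ℕ.n∸n≡0 m = trans (×-homo-1 _) (*-identityʳ _)

  ^p^-suc : ∀ x j → x ^ (p ℕ.^ suc j) ≈ (x ^ (p ℕ.^ j)) ^ p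
  ^p^-suc x j = trans (^-congʳ x (ℕ.*-comm p (p ℕ.^ j))) (sym (^-assocʳ x (p ℕ.^ j) p))

  ^p^-+ : ∀ j x y → (x + y) ^ (p ℕ.^ j) ≈ x ^ (p ℕ.^ j) + y ^ (p ℕ.^ j)
  ^p^-+ zero x y = trans (*-identityʳ _) (sym (+-cong (*-identityʳ x) (*-identityʳ y)))
  ^p^-+ (suc j) x y = begin
    (x + y) ^ (p ℕ.^ suc j)                       ≈⟨ ^p^-suc (x + y) j ⟩
    ((x + y) ^ (p ℕ.^ j)) ^ p                     ≈⟨ ^-congˡ p (^p^-+ j x y) ⟩
    (x ^ (p ℕ.^ j) + y ^ (p ℕ.^ j)) ^ p           ≈⟨ frobenius-+ _ _ ⟩
    (x ^ (p ℕ.^ j)) ^ p + (y ^ (p ℕ.^ j)) ^ p     ≈⟨ +-cong (^p^-suc x j) (^p^-suc y j) ⟨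
    x ^ (p ℕ.^ suc j) + y ^ (p ℕ.^ suc j)         ∎

  1^ : ∀ n → 1# ^ n ≈ 1#
  1^ zero = refl
  1^ (suc n) = trans (*-identityˡ _) (1^ n)

  0^p^ : ∀ j → 0# ^ (p ℕ.^ j) ≈ 0#
  0^p^ j with p ℕ.^ j | ℕ.m^n≢0 p j {{prime⇒nonZero prime}}
  ... | suc _ | _ = zeroˡ _

  -- Fermat's little theorem, by induction on `n` from the additivity of Frobenius.
  ^p^-·1 : ∀ j n → (n · 1#) ^ (p ℕ.^ j) ≈ n · 1#
  ^p^-·1 j zero = 0^p^ j
  ^p^-·1 j (suc n) = trans (^p^-+ j 1# (n · 1#)) (+-cong (1^ (p ℕ.^ j)) (^p^-·1 j n))

-- Polynomials and interpolation over a field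

module Polynomial {c ℓ} (K : CommutativeRing c ℓ) where

  open CommutativeRing K
  open import Algebra.Properties.Semiring.Exp semiring using (_^_)
  open import Algebra.Solver.Ring.NaturalCoefficients.Default commutativeSemiring
    using (solve; _:=_; _:+_; _:*_; con)
  open import Relation.Binary.Reasoning.Setoid setoid

  eval : ∀ {n} → (Fin n → Carrier) → Carrier → Carrier
  eval {zero}  f x = 0#
  eval {suc n} f x = f fzero + x * eval (f ∘ fsuc) x

  eval-cong : ∀ {n} {f g : Fin n → Carrier} {x y} → (∀ i → f i ≈ g i) → x ≈ y → eval f x ≈ eval g y
  eval-cong {zero}  f≈g x≈y = refl
  eval-cong {suc n} f≈g x≈y = +-cong (f≈g fzero) (*-cong x≈y (eval-cong (f≈g ∘ fsuc) x≈y))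

  eval-0 : ∀ n x → eval {n} (λ _ → 0#) x ≈ 0#
  eval-0 zero x = refl
  eval-0 (suc n) x = trans (+-identityˡ _) (trans (*-congˡ (eval-0 n x)) (zeroʳ x))

  eval-+ : ∀ {n} (f g : Fin n → Carrier) x → eval f x + eval g x ≈ eval (λ i → f i + g i) x
  eval-+ {zero}  f g x = +-identityˡ 0#
  eval-+ {suc n} f g x = trans
    (solve 5 (λ a b u v x → (a :+ x :* u) :+ (b :+ x :* v) := (a :+ b) :+ x :* (u :+ v)) refl _ _ _ _ x)
    (+-congˡ (*-congˡ (eval-+ (f ∘ fsuc) (g ∘ fsuc) x)))

  eval-* : ∀ {n} c (f : Fin n → Carrier) x → c * eval f x ≈ eval (λ i → c * f i) x
  eval-* {zero}  c f x = zeroʳ c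
  eval-* {suc n} c f x = trans
    (solve 4 (λ a c u x → c :* (a :+ x :* u) := c :* a :+ x :* (c :* u)) refl _ c _ x)
    (+-congˡ (*-congˡ (eval-* c (f ∘ fsuc) x)))

  eval-last : ∀ {n} (f : Fin (suc n) → Carrier) x →
    eval f x ≈ eval (f ∘ inject₁) x + x ^ n * f (fromℕ n)
  eval-last {zero}  f x = solve 2 (λ a x → a :+ x :* con 0 := con 0 :+ con 1 :* a) refl (f fzero) x
  eval-last {suc n} f x = trans (+-congˡ (*-congˡ (eval-last (f ∘ fsuc) x)))
    (solve 5 (λ a u y l x → a :+ x :* (u :+ y :* l) := (a :+ x :* u) :+ (x :* y) :* l) refl
      (f fzero) (eval (f ∘ fsuc ∘ inject₁) x) (x ^ n) (f (fromℕ (suc n))) x)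

  -- The leading coefficient wraps around to the constant term. Hence the span of 1, x, ..., x ^ n
  -- is closed under multiplication by `x`.
  eval-rotate : ∀ {n} (f : Fin (suc n) → Carrier) {x} → x ^ suc n ≈ 1# →
    x * eval f x ≈ f (fromℕ n) + x * eval (f ∘ inject₁) x
  eval-rotate {n} f {x} xⁿ⁺¹≈1 = begin
    x * eval f x
      ≈⟨ *-congˡ (eval-last f x) ⟩
    x * (u + x ^ n * l)
      ≈⟨ solve 4 (λ x u y l → x :* (u :+ y :* l) := (x :* y) :* l :+ x :* u) refl x u (x ^ n) l ⟩
    x ^ suc n * l + x * u
      ≈⟨ +-congʳ (trans (*-congʳ xⁿ⁺¹≈1) (*-identityˡ l)) ⟩
    l + x * u ∎
    where
    u = eval (f ∘ inject₁) x
    l = f (fromℕ n)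

  monomial : ∀ {n} → Fin n → Fin n → Carrier
  monomial fzero    fzero    = 1#
  monomial fzero    (fsuc j) = 0#
  monomial (fsuc i) fzero    = 0#
  monomial (fsuc i) (fsuc j) = monomial i j

  monomial-diag : ∀ {n} (i : Fin n) → monomial i i ≈ 1#
  monomial-diag fzero    = refl
  monomial-diag (fsuc i) = monomial-diag i

  eval-monomial : ∀ {n} (i : Fin n) x → eval (monomial i) x ≈ x ^ toℕ i
  eval-monomial {suc n} fzero    x = trans (+-congˡ (trans (*-congˡ (eval-0 n x)) (zeroʳ x))) (+-identityʳ 1#)
  eval-monomial         (fsuc i) x = trans (+-identityˡ _) (*-congˡ (eval-monomial i x))

  -- For c = c₀ + X f, the quotient of c by X - r is independent of c₀.
  quotient : ∀ {n} → Carrier → (Fin n → Carrier) → Fin n → Carrier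
  quotient r f fzero    = eval f r
  quotient r f (fsuc i) = quotient r (f ∘ fsuc) i

  -- This is f(x) - f(r) = (x - r) Q(x), with the negative terms moved across so that a semiring
  -- solver suffices.
  eval-quotient : ∀ {n} r x (f : Fin (suc n) → Carrier) →
    eval f x + r * eval (quotient r (f ∘ fsuc)) x ≈ eval f r + x * eval (quotient r (f ∘ fsuc)) x
  eval-quotient {zero} r x f =
    solve 3 (λ a r x → (a :+ x :* con 0) :+ r :* con 0 := (a :+ r :* con 0) :+ x :* con 0) refl (f fzero) r x
  eval-quotient {suc n} r x f = begin
    (a + x * u) + r * (v + x * w)
      ≈⟨ solve 6 (λ a u v w r x → (a :+ x :* u) :+ r :* (v :+ x :* w) := a :+ (x :* (u :+ r :* w) :+ r :* v)) refl a u v w r x ⟩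
    a + (x * (u + r * w) + r * v)
      ≈⟨ +-congˡ (+-congʳ (*-congˡ (eval-quotient r x (f ∘ fsuc)))) ⟩
    a + (x * (v + x * w) + r * v)
      ≈⟨ solve 5 (λ a v w r x → a :+ (x :* (v :+ x :* w) :+ r :* v) := (a :+ r :* v) :+ x :* (v :+ x :* w)) refl a v w r x ⟩
    (a + r * v) + x * (v + x * w) ∎
    where
    a = f fzero
    u = eval (f ∘ fsuc) x
    v = eval (f ∘ fsuc) r
    w = eval (quotient r (f ∘ fsuc ∘ fsuc)) x

IsField : ∀ {c ℓ} → CommutativeRing c ℓ → Set _
IsField K = ¬ (1# ≈ 0#) × (∀ y → (y ≈ 0#) ⊎ ∃ λ z → (y * z) ≈ 1#)
  where open CommutativeRing K

module Field {c ℓ} (K : CommutativeRing c ℓ) (isField : IsField K) where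

  open CommutativeRing K
  open Polynomial K
  open import Algebra.Properties.Group +-group using (∙-cancelʳ; ∙-cancelˡ; x∙y⁻¹≈ε⇒x≈y)
  open import Algebra.Solver.Ring.NaturalCoefficients.Default commutativeSemiring
    using (solve; _:=_; _:+_; _:*_)
  open import Relation.Binary.Reasoning.Setoid setoid

  1≉0 : ¬ (1# ≈ 0#)
  1≉0 = proj₁ isField

  *-cancelˡ : ∀ {x y z} → ¬ (x ≈ 0#) → x * y ≈ x * z → y ≈ z
  *-cancelˡ {x} {y} {z} x≉0 xy≈xz with proj₂ isField x
  ... | inj₁ x≈0 = ⊥-elim (x≉0 x≈0)
  ... | inj₂ (w , xw≈1) = begin
    y             ≈⟨ undo y ⟨
    w * (x * y)   ≈⟨ *-congˡ xy≈xz ⟩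
    w * (x * z)   ≈⟨ undo z ⟩
    z             ∎
    where
    undo : ∀ u → w * (x * u) ≈ u
    undo u = begin
      w * (x * u)   ≈⟨ *-assoc w x u ⟨
      (w * x) * u   ≈⟨ *-congʳ (trans (*-comm w x) xw≈1) ⟩
      1# * u        ≈⟨ *-identityˡ u ⟩
      u             ∎

  -- (x - r)(u - v) ≈ 0 with the negative terms moved across.
  cross-cancel : ∀ {x r u v} → ¬ (x ≈ r) → x * u + r * v ≈ x * v + r * u → u ≈ v
  cross-cancel {x} {r} {u} {v} x≉r eq = *-cancelˡ d≉0 (∙-cancelʳ (r * u + r * v) _ _ (begin
    d * u + (r * u + r * v)   ≈⟨ solve 4 (λ d r u v → d :* u :+ (r :* u :+ r :* v) := (d :+ r) :* u :+ r :* v) refl d r u v ⟩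
    (d + r) * u + r * v       ≈⟨ +-congʳ (*-congʳ d+r≈x) ⟩
    x * u + r * v             ≈⟨ eq ⟩
    x * v + r * u             ≈⟨ +-congʳ (*-congʳ d+r≈x) ⟨
    (d + r) * v + r * u       ≈⟨ solve 4 (λ d r u v → (d :+ r) :* v :+ r :* u := d :* v :+ (r :* u :+ r :* v)) refl d r u v ⟩
    d * v + (r * u + r * v)   ∎))
    where
    d = x - r
    d≉0 : ¬ (d ≈ 0#)
    d≉0 d≈0 = x≉r (x∙y⁻¹≈ε⇒x≈y x r d≈0)
    d+r≈x : d + r ≈ x
    d+r≈x = trans (+-assoc x (- r) r) (trans (+-congˡ (-‿inverseˡ r)) (+-identityʳ x))

  eval-head-cancel : ∀ {n r} {f g : Fin (suc n) → Carrier} → eval f r ≈ eval g r →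
    (∀ i → f (fsuc i) ≈ g (fsuc i)) → ∀ i → f i ≈ g i
  eval-head-cancel {r = r} {f} {g} eq tails fzero = ∙-cancelʳ (r * eval (f ∘ fsuc) r) _ _
    (trans eq (+-congˡ (*-congˡ (eval-cong (sym ∘ tails) refl))))
  eval-head-cancel eq tails (fsuc i) = tails i

  -- Entry i of the quotient is the value at `r` of the coefficients from i onwards, so once the
  -- tails agree the head cancels.
  quotient-injective : ∀ {n} r (f g : Fin n → Carrier) →
    (∀ i → quotient r f i ≈ quotient r g i) → ∀ i → f i ≈ g i
  quotient-injective {suc n} r f g eq =
    eval-head-cancel (eq fzero) (quotient-injective r (f ∘ fsuc) (g ∘ fsuc) (eq ∘ fsuc))

  -- Dividing both polynomials by X - r₀ removes one coefficient and one point; the quotients still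
  -- agree at the other points because x - r₀ is invertible there.
  eval-injective : ∀ {n} (f g r : Fin n → Carrier) → (∀ {i j} → r i ≈ r j → i ≡ j) →
    (∀ i → eval f (r i) ≈ eval g (r i)) → ∀ i → f i ≈ g i
  eval-injective {suc n} f g r r-injective eq = eval-head-cancel (eq fzero)
    (quotient-injective r₀ (f ∘ fsuc) (g ∘ fsuc)
      (eval-injective F G (r ∘ fsuc) (Fin.suc-injective ∘ r-injective) quotients-agree))
    where
    r₀ = r fzero
    F = quotient r₀ (f ∘ fsuc)
    G = quotient r₀ (g ∘ fsuc)
    quotients-agree : ∀ i → eval F (r (fsuc i)) ≈ eval G (r (fsuc i))
    quotients-agree i = cross-cancel (λ x≈r₀ → Fin.0≢1+n (≡.sym (r-injective x≈r₀)))
      -- The division identities of `f` and `g` are added in opposite directions; the cancelled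
      -- summand is what both sides then share.
      (∙-cancelˡ (eval f r₀ + eval g x) _ _ (begin
        (eval f r₀ + eval g x) + (x * u + r₀ * v)
          ≈⟨ shuffle _ _ _ _ ⟩
        (eval f r₀ + x * u) + (eval g x + r₀ * v)
          ≈⟨ +-cong (sym (eval-quotient r₀ x f)) (eval-quotient r₀ x g) ⟩
        (eval f x + r₀ * u) + (eval g r₀ + x * v)
          ≈⟨ +-cong (+-congʳ (eq (fsuc i))) (+-congʳ (sym (eq fzero))) ⟩
        (eval g x + r₀ * u) + (eval f r₀ + x * v)
          ≈⟨ solve 4 (λ a b c d → (a :+ b) :+ (c :+ d) := (c :+ a) :+ (d :+ b)) refl _ _ _ _ ⟩
        (eval f r₀ + eval g x) + (x * v + r₀ * u) ∎))
      where
      x = r (fsuc i)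
      u = eval F x
      v = eval G x
      shuffle : ∀ a b c d → (a + b) + (c + d) ≈ (a + c) + (b + d)
      shuffle = solve 4 (λ a b c d → (a :+ b) :+ (c :+ d) := (a :+ c) :+ (b :+ d)) refl

-- The ring of polynomials in the shift operator

-- A polynomial acts on sequences through the shift operator X.  Identifying polynomials that agree
-- on one sequence s yields F[X] modulo the annihilator of s.
module ShiftOperators {c ℓ} (F : CommutativeRing c ℓ) where

  open CommutativeRing F
  open import Algebra.Properties.Ring ring using (-1*x≈-x)

  Sequence : Set c
  Sequence = ℕ → Carrier

  infixl 6 _⊕_
  infixl 7 _⊗_

  -- Ring elements are kept as expressions, so that a property of all of them can be proved by
  -- induction on constants, `X`, sums and products.
  data Operator : Set c where
    const   : Carrier → Operator
    X       : Operator
    _⊕_ _⊗_ : Operator → Operator → Operator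

  infix 10 ⟦_⟧

  ⟦_⟧ : Operator → Sequence → Sequence
  ⟦ const c ⟧ t m = c * t m
  ⟦ X ⟧       t m = t (suc m)
  ⟦ a ⊕ b ⟧   t m = ⟦ a ⟧ t m + ⟦ b ⟧ t m
  ⟦ a ⊗ b ⟧   t   = ⟦ a ⟧ (⟦ b ⟧ t)

  ⟦⟧-cong : ∀ a {t u} → (∀ m → t m ≈ u m) → ∀ m → ⟦ a ⟧ t m ≈ ⟦ a ⟧ u m
  ⟦⟧-cong (const c) t≈u m = *-congˡ (t≈u m)
  ⟦⟧-cong X         t≈u m = t≈u (suc m)
  ⟦⟧-cong (a ⊕ b)   t≈u m = +-cong (⟦⟧-cong a t≈u m) (⟦⟧-cong b t≈u m)
  ⟦⟧-cong (a ⊗ b)   t≈u   = ⟦⟧-cong a (⟦⟧-cong b t≈u)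

  ⟦⟧-+ : ∀ a t u m → ⟦ a ⟧ (λ i → t i + u i) m ≈ ⟦ a ⟧ t m + ⟦ a ⟧ u m
  ⟦⟧-+ (const c) t u m = distribˡ c (t m) (u m)
  ⟦⟧-+ X         t u m = refl
  ⟦⟧-+ (a ⊕ b)   t u m = trans (+-cong (⟦⟧-+ a t u m) (⟦⟧-+ b t u m)) (interchange _ _ _ _)
    where open import Algebra.Properties.CommutativeSemigroup +-commutativeSemigroup using (interchange)
  ⟦⟧-+ (a ⊗ b)   t u m = trans (⟦⟧-cong a (⟦⟧-+ b t u) m) (⟦⟧-+ a _ _ m)

  ⟦⟧-* : ∀ a c t m → ⟦ a ⟧ (λ i → c * t i) m ≈ c * ⟦ a ⟧ t m
  ⟦⟧-* (const d) c t m = x∙yz≈y∙xz d c (t m)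
    where open import Algebra.Properties.CommutativeSemigroup *-commutativeSemigroup using (x∙yz≈y∙xz)
  ⟦⟧-* X         c t m = refl
  ⟦⟧-* (a ⊕ b)   c t m = trans (+-cong (⟦⟧-* a c t m) (⟦⟧-* b c t m)) (sym (distribˡ c _ _))
  ⟦⟧-* (a ⊗ b)   c t m = trans (⟦⟧-cong a (⟦⟧-* b c t) m) (⟦⟧-* a c _ m)

  ⟦⟧-shift : ∀ a t m → ⟦ a ⟧ (t ∘ suc) m ≈ ⟦ a ⟧ t (suc m)
  ⟦⟧-shift (const c) t m = refl
  ⟦⟧-shift X         t m = refl
  ⟦⟧-shift (a ⊕ b)   t m = +-cong (⟦⟧-shift a t m) (⟦⟧-shift b t m)
  ⟦⟧-shift (a ⊗ b)   t m = trans (⟦⟧-cong a (⟦⟧-shift b t) m) (⟦⟧-shift a _ m)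

  ⟦⟧-commute : ∀ a b t m → ⟦ a ⟧ (⟦ b ⟧ t) m ≈ ⟦ b ⟧ (⟦ a ⟧ t) m
  ⟦⟧-commute (const c) b t m = sym (⟦⟧-* b c t m)
  ⟦⟧-commute X         b t m = sym (⟦⟧-shift b t m)
  ⟦⟧-commute (a ⊕ a′)  b t m =
    trans (+-cong (⟦⟧-commute a b t m) (⟦⟧-commute a′ b t m)) (sym (⟦⟧-+ b _ _ m))
  ⟦⟧-commute (a ⊗ a′)  b t m = trans (⟦⟧-cong a (⟦⟧-commute a′ b t) m) (⟦⟧-commute a b _ m)

  -- A record, so that a and b can be inferred from a proof of a ≈[ s ] b.
  infix 4 _≈[_]_
  record _≈[_]_ (a : Operator) (s : Sequence) (b : Operator) : Set ℓ where
    constructor agree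
    field at : ∀ m → ⟦ a ⟧ s m ≈ ⟦ b ⟧ s m
  open _≈[_]_ public

  operatorRing : Sequence → CommutativeRing c ℓ
  operatorRing s = record
    { Carrier = Operator
    ; _≈_ = _≈[ s ]_
    ; _+_ = _⊕_
    ; _*_ = _⊗_
    ; -_ = const (- 1#) ⊗_
    ; 0# = const 0#
    ; 1# = const 1#
    ; isCommutativeRing = record
      { isRing = record
        { +-isAbelianGroup = record
          { isGroup = record
            { isMonoid = record
              { isSemigroup = record
                { isMagma = record
                  { isEquivalence = record
                    { refl  = agree λ m → refl
                    ; sym   = λ a≈b → agree λ m → sym (at a≈b m)
                    ; trans = λ a≈b b≈c → agree λ m → trans (at a≈b m) (at b≈c m)
                    }
                  ; ∙-cong = λ a≈b c≈d → agree λ m → +-cong (at a≈b m) (at c≈d m)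
                  }
                ; assoc = λ a b c → agree λ m → +-assoc _ _ _
                }
              ; identity = (λ a → agree λ m → trans (+-congʳ (zeroˡ _)) (+-identityˡ _))
                         , (λ a → agree λ m → trans (+-congˡ (zeroˡ _)) (+-identityʳ _))
              }
            ; inverse = (λ a → agree λ m → trans (+-congʳ (-1*x≈-x _)) (trans (-‿inverseˡ _) (sym (zeroˡ _))))
                      , (λ a → agree λ m → trans (+-congˡ (-1*x≈-x _)) (trans (-‿inverseʳ _) (sym (zeroˡ _))))
            ; ⁻¹-cong = λ a≈b → agree λ m → *-congˡ (at a≈b m)
            }
          ; comm = λ a b → agree λ m → +-comm _ _
          }
        -- `a` and `a′` are known to agree on `s` only, so the factors are commuted until they act
        -- on `s` itself.
        ; *-cong = λ {a} {a′} {b} {b′} a≈a′ b≈b′ → agree λ m → trans (⟦⟧-cong a (at b≈b′) m)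
            (trans (⟦⟧-commute a b′ s m) (trans (⟦⟧-cong b′ (at a≈a′) m) (⟦⟧-commute b′ a′ s m)))
        ; *-assoc = λ a b c → agree λ m → refl
        ; *-identity = (λ a → agree λ m → *-identityˡ _) , (λ a → agree (⟦⟧-cong a (λ m → *-identityˡ _)))
        ; distrib = (λ a b c → agree (⟦⟧-+ a _ _)) , (λ a b c → agree λ m → refl)
        }
      ; *-comm = λ a b → agree λ m → ⟦⟧-commute a b s m
      }
    }

  module _ (s : Sequence) where
    private module R = CommutativeRing (operatorRing s)
    open import Algebra.Properties.Semiring.Exp R.semiring using (_^_)

    ⟦X^_⟧ : ∀ j t m → ⟦ X ^ j ⟧ t m ≈ t (j ℕ.+ m)
    ⟦X^ zero ⟧  t m = *-identityˡ (t m)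
    ⟦X^ suc j ⟧ t m = trans (⟦X^ j ⟧ t (suc m)) (reflexive (≡.cong t (ℕ.+-suc j m)))

  -- a has leading term X ^ d: on windows starting with d zeros only that term is visible.
  Monic : ℕ → Operator → Set _
  Monic d a = ∀ t m → (∀ i → i < d → t (m ℕ.+ i) ≈ 0#) → ⟦ a ⟧ t m ≈ t (m ℕ.+ d)

  monic-1 : Monic 0 (const 1#)
  monic-1 t m _ = trans (*-identityˡ _) (reflexive (≡.cong t (≡.sym (ℕ.+-identityʳ m))))

  -- Inside a window of d + e zeros `b` acts as a shift by e, so `⟦ b ⟧ t` has a window of d zeros
  -- there, as `a` requires.
  monic-⊗ : ∀ {d e a b} → Monic d a → Monic e b → Monic (d ℕ.+ e) (a ⊗ b)
  monic-⊗ {d} {e} {a} {b} monic-a monic-b t m zeros =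
    trans (monic-a (⟦ b ⟧ t) m (λ i i<d → trans (bt i (ℕ.<⇒≤ i<d)) (zeros (i ℕ.+ e) (ℕ.+-monoˡ-< e i<d)))) (bt d ℕ.≤-refl)
    where
    bt : ∀ i → i ≤ d → ⟦ b ⟧ t (m ℕ.+ i) ≈ t (m ℕ.+ (i ℕ.+ e))
    bt i i≤d = trans (monic-b t (m ℕ.+ i) (λ j j<e →
        trans (reflexive (≡.cong t (ℕ.+-assoc m i j))) (zeros (i ℕ.+ j) (ℕ.+-mono-≤-< i≤d j<e))))
      (reflexive (≡.cong t (ℕ.+-assoc m i e)))

  module Periodic {n} .{{_ : NonZero n}} {s : Sequence} (period : ∀ m → s (n ℕ.+ m) ≈ s m)
    (_≟_ : Decidable _≈_) where

    private module R = CommutativeRing (operatorRing s)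
    open import Algebra.Properties.Semiring.Exp R.semiring using (_^_)

    X^n≈1 : X ^ n R.≈ R.1#
    X^n≈1 = agree λ m → trans (⟦X^_⟧ s n s m) (trans (period m) (sym (*-identityˡ _)))

    ⟦⟧-period : ∀ a m → ⟦ a ⟧ s (n ℕ.+ m) ≈ ⟦ a ⟧ s m
    ⟦⟧-period a m = trans (sym (⟦X^_⟧ s n _ m)) (trans (⟦⟧-commute (X ^ n) a s m)
      (⟦⟧-cong a (λ i → trans (at X^n≈1 i) (*-identityˡ _)) m))

    ⟦⟧-periods : ∀ a k m → ⟦ a ⟧ s (m ℕ.+ k ℕ.* n) ≈ ⟦ a ⟧ s m
    ⟦⟧-periods a zero    m = reflexive (≡.cong (⟦ a ⟧ s) (ℕ.+-identityʳ m))
    ⟦⟧-periods a (suc k) m = trans (reflexive (≡.cong (⟦ a ⟧ s) eq))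
      (trans (⟦⟧-period a _) (⟦⟧-periods a k m))
      where
      eq : m ℕ.+ (n ℕ.+ k ℕ.* n) ≡ n ℕ.+ (m ℕ.+ k ℕ.* n)
      eq = ≡.trans (≡.sym (ℕ.+-assoc m n _)) (≡.trans (≡.cong (ℕ._+ k ℕ.* n) (ℕ.+-comm m n)) (ℕ.+-assoc n m _))

    ⟦⟧-% : ∀ a m → ⟦ a ⟧ s m ≈ ⟦ a ⟧ s (m % n)
    ⟦⟧-% a m = trans (reflexive (≡.cong (⟦ a ⟧ s) (m≡m%n+[m/n]*n m n))) (⟦⟧-periods a (m / n) (m % n))

    -- Every operator commutes with `X ^ n`, so its effect on `s` inherits the period of `s` and n
    -- positions decide equality.
    _≟ᴿ_ : Decidable R._≈_
    a ≟ᴿ b = map′ (agree ∘ extend) (λ a≈b i → at a≈b (toℕ i)) (Fin.all? λ i → ⟦ a ⟧ s (toℕ i) ≟ ⟦ b ⟧ s (toℕ i))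
      where
      extend : (∀ (i : Fin n) → ⟦ a ⟧ s (toℕ i) ≈ ⟦ b ⟧ s (toℕ i)) → ∀ m → ⟦ a ⟧ s m ≈ ⟦ b ⟧ s m
      extend eq m = trans (⟦⟧-% a m) (trans (≡.subst (λ j → ⟦ a ⟧ s j ≈ ⟦ b ⟧ s j)
        (Fin.toℕ-fromℕ< (m%n<n m n)) (eq (fromℕ< (m%n<n m n)))) (sym (⟦⟧-% b m)))

-- Passing to a field factor

-- R / Ann(e); when e is idempotent this is the factor ring R e.
module Annihilator {c ℓ} (R : CommutativeRing c ℓ) (e : CommutativeRing.Carrier R) where

  open CommutativeRing R

  infix 4 _≈ₑ_
  record _≈ₑ_ (a b : Carrier) : Set ℓ where
    constructor annihilated
    field scaled : e * a ≈ e * b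
  open _≈ₑ_ public

  private
    ≈⇒≈ₑ : ∀ {a b} → a ≈ b → a ≈ₑ b
    ≈⇒≈ₑ a≈b = annihilated (*-congˡ a≈b)

    sym≈ₑ : ∀ {a b} → a ≈ₑ b → b ≈ₑ a
    sym≈ₑ (annihilated ea≈eb) = annihilated (sym ea≈eb)

    trans≈ₑ : ∀ {a b c} → a ≈ₑ b → b ≈ₑ c → a ≈ₑ c
    trans≈ₑ (annihilated ea≈eb) (annihilated eb≈ec) = annihilated (trans ea≈eb eb≈ec)

    +-congₑ : ∀ {a b c d} → a ≈ₑ b → c ≈ₑ d → a + c ≈ₑ b + d
    +-congₑ (annihilated ea≈eb) (annihilated ec≈ed) = annihilated
      (trans (distribˡ e _ _) (trans (+-cong ea≈eb ec≈ed) (sym (distribˡ e _ _))))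

    *-congʳₑ : ∀ {a b c} → a ≈ₑ b → a * c ≈ₑ b * c
    *-congʳₑ (annihilated ea≈eb) = annihilated
      (trans (sym (*-assoc e _ _)) (trans (*-congʳ ea≈eb) (*-assoc e _ _)))

    *-congₑ : ∀ {a b c d} → a ≈ₑ b → c ≈ₑ d → a * c ≈ₑ b * d
    *-congₑ {b = b} {c} {d} a≈b c≈d = trans≈ₑ (*-congʳₑ a≈b)
      (trans≈ₑ (≈⇒≈ₑ (*-comm b c)) (trans≈ₑ (*-congʳₑ c≈d) (≈⇒≈ₑ (*-comm d b))))

    neg-congₑ : ∀ {a b} → a ≈ₑ b → - a ≈ₑ - b
    neg-congₑ (annihilated ea≈eb) = annihilated
      (trans (sym (-‿distribʳ-* e _)) (trans (-‿cong ea≈eb) (-‿distribʳ-* e _)))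
      where open import Algebra.Properties.Ring ring using (-‿distribʳ-*)

  quotientRing : CommutativeRing c ℓ
  quotientRing = record
    { Carrier = Carrier
    ; _≈_ = _≈ₑ_
    ; _+_ = _+_
    ; _*_ = _*_
    ; -_ = -_
    ; 0# = 0#
    ; 1# = 1#
    ; isCommutativeRing = record
      { isRing = record
        { +-isAbelianGroup = record
          { isGroup = record
            { isMonoid = record
              { isSemigroup = record
                { isMagma = record
                  { isEquivalence = record { refl = ≈⇒≈ₑ refl ; sym = sym≈ₑ ; trans = trans≈ₑ }
                  ; ∙-cong = +-congₑ
                  }
                ; assoc = λ x y z → ≈⇒≈ₑ (+-assoc x y z)
                }
              ; identity = (λ x → ≈⇒≈ₑ (+-identityˡ x)) , (λ x → ≈⇒≈ₑ (+-identityʳ x))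
              }
            ; inverse = (λ x → ≈⇒≈ₑ (-‿inverseˡ x)) , (λ x → ≈⇒≈ₑ (-‿inverseʳ x))
            ; ⁻¹-cong = neg-congₑ
            }
          ; comm = λ x y → ≈⇒≈ₑ (+-comm x y)
          }
        ; *-cong = *-congₑ
        ; *-assoc = λ x y z → ≈⇒≈ₑ (*-assoc x y z)
        ; *-identity = (λ x → ≈⇒≈ₑ (*-identityˡ x)) , (λ x → ≈⇒≈ₑ (*-identityʳ x))
        ; distrib = (λ x y z → ≈⇒≈ₑ (distribˡ x y z)) , (λ x y z → ≈⇒≈ₑ (distribʳ x y z))
        }
      ; *-comm = λ x y → ≈⇒≈ₑ (*-comm x y)
      }
    }

  private module Q = CommutativeRing quotientRing
  import Algebra.Properties.Semiring.Mult as Mult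
  import Algebra.Properties.Semiring.Exp as Exp
  open Mult semiring using () renaming (_×_ to _·_)
  open Mult Q.semiring using () renaming (_×_ to _·ₑ_)
  open Exp semiring using (_^_)
  open Exp Q.semiring using () renaming (_^_ to _^ₑ_)

  -- The two sides are built from different bundles, hence not definitionally equal.
  ^ₑ≡^ : ∀ a m → a ^ₑ m ≡ a ^ m
  ^ₑ≡^ a zero    = ≡.refl
  ^ₑ≡^ a (suc m) = ≡.cong (a *_) (^ₑ≡^ a m)

  ·ₑ≡· : ∀ m a → m ·ₑ a ≡ m · a
  ·ₑ≡· zero    a = ≡.refl
  ·ₑ≡· (suc m) a = ≡.cong (a +_) (·ₑ≡· m a)

  quotient-killedBy : ∀ p → KilledBy p R → KilledBy p quotientRing
  quotient-killedBy p p·1≈0 = Q.trans (Q.reflexive (·ₑ≡· p 1#)) (≈⇒≈ₑ p·1≈0)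

  quotient-^ : ∀ a m → a ^ m ≈ a → a ^ₑ m ≈ₑ a
  quotient-^ a m aᵐ≈a = Q.trans (Q.reflexive (^ₑ≡^ a m)) (≈⇒≈ₑ aᵐ≈a)

  ≈ₑ-decidable : Decidable _≈_ → Decidable _≈ₑ_
  ≈ₑ-decidable _≟_ a b = map′ annihilated scaled ((e * a) ≟ (e * b))

PowerIdentity : ∀ {c ℓ} → ℕ → CommutativeRing c ℓ → Set _
PowerIdentity m K = ∀ y → (y ^ m) ≈ y
  where
  open CommutativeRing K
  open import Algebra.Properties.Semiring.Exp semiring using (_^_)

-- If every y satisfies y ^ (n + 1) = y, then y ^ n is idempotent, so multiplying a nonzero e by y ^ n
-- whenever the product stays nonzero ends, after all y, in an e for which R / Ann(e) is a field.
module FieldFactor {c ℓ} (R : CommutativeRing c ℓ) (_≟_ : Decidable (CommutativeRing._≈_ R))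
  (n-1 : ℕ) (powerIdentity : PowerIdentity (suc (suc n-1)) R) where

  open CommutativeRing R
  open import Algebra.Properties.Semiring.Exp semiring using (_^_; ^-congˡ)
  open import Algebra.Properties.CommutativeSemigroup *-commutativeSemigroup
    using (xy∙z≈xz∙y; x∙yz≈y∙xz)
  open import Relation.Binary.Reasoning.Setoid setoid
  open Annihilator R

  private
    n = suc n-1

  ^n-idempotent : ∀ y → y ^ n * y ^ n ≈ y ^ n
  ^n-idempotent y = begin
    (y * y ^ n-1) * y ^ n   ≈⟨ xy∙z≈xz∙y y (y ^ n-1) (y ^ n) ⟩
    (y * y ^ n) * y ^ n-1   ≈⟨ *-congʳ (powerIdentity y) ⟩
    y * y ^ n-1             ∎

  -- The idempotent `y ^ n` becomes 0 or 1 in R / Ann(e), so y becomes zero or invertible there.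
  Splits : Carrier → Carrier → Set ℓ
  Splits e y = e * y ^ n ≈ 0# ⊎ e * y ^ n ≈ e

  -- Decisions made for earlier elements survive when `e` is multiplied further.
  splits-multiple : ∀ {e e′ w y} → e′ ≈ e * w → Splits e y → Splits e′ y
  splits-multiple {e} {e′} {w} {y} e′≈ew = λ where
      (inj₁ eyⁿ≈0) → inj₁ (trans e′yⁿ≈ (trans (*-congʳ eyⁿ≈0) (zeroˡ w)))
      (inj₂ eyⁿ≈e) → inj₂ (trans e′yⁿ≈ (trans (*-congʳ eyⁿ≈e) (sym e′≈ew)))
    where
    e′yⁿ≈ : e′ * y ^ n ≈ (e * y ^ n) * w
    e′yⁿ≈ = trans (*-congʳ e′≈ew) (xy∙z≈xz∙y e w (y ^ n))

  splits-resp : ∀ {e y z} → y ≈ z → Splits e z → Splits e y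
  splits-resp y≈z (inj₁ ezⁿ≈0) = inj₁ (trans (*-congˡ (^-congˡ n y≈z)) ezⁿ≈0)
  splits-resp y≈z (inj₂ ezⁿ≈e) = inj₂ (trans (*-congˡ (^-congˡ n y≈z)) ezⁿ≈e)

  splitting-multiple : ∀ ys e → ¬ (e ≈ 0#) →
    ∃ λ e′ → ¬ (e′ ≈ 0#) × (∃ λ w → e′ ≈ e * w) × All (Splits e′) ys
  splitting-multiple [] e e≉0 = e , e≉0 , (1# , sym (*-identityʳ e)) , []
  splitting-multiple (y ∷ ys) e e≉0 with (e * y ^ n) ≟ 0#
  ... | yes eyⁿ≈0 with splitting-multiple ys e e≉0
  ...   | e′ , e′≉0 , (w , e′≈ew) , splits =
    e′ , e′≉0 , (w , e′≈ew) , splits-multiple e′≈ew (inj₁ eyⁿ≈0) ∷ splits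
  splitting-multiple (y ∷ ys) e e≉0 | no eyⁿ≉0 with splitting-multiple ys (e * y ^ n) eyⁿ≉0
  ...   | e′ , e′≉0 , (w , e′≈eyⁿw) , splits =
    e′ , e′≉0 , (y ^ n * w , trans e′≈eyⁿw (*-assoc e (y ^ n) w)) ,
    splits-multiple e′≈eyⁿw (inj₂ (trans (*-assoc e _ _) (*-congˡ (^n-idempotent y)))) ∷ splits

  quotient-isField : ∀ e → ¬ (e ≈ 0#) → (∀ y → Splits e y) → IsField (quotientRing e)
  quotient-isField e e≉0 splits = 1≉0 , invertible
    where
    1≉0 : ¬ (_≈ₑ_ e 1# 0#)
    1≉0 (annihilated e1≈e0) = e≉0 (trans (sym (*-identityʳ e)) (trans e1≈e0 (zeroʳ e)))
    invertible : ∀ y → (_≈ₑ_ e y 0#) ⊎ ∃ λ z → _≈ₑ_ e (y * z) 1#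
    invertible y with splits y
    ... | inj₁ eyⁿ≈0 = inj₁ (annihilated (begin
      e * y             ≈⟨ *-congˡ (powerIdentity y) ⟨
      e * (y * y ^ n)   ≈⟨ x∙yz≈y∙xz e y (y ^ n) ⟩
      y * (e * y ^ n)   ≈⟨ *-congˡ eyⁿ≈0 ⟩
      y * 0#            ≈⟨ zeroʳ y ⟩
      0#                ≈⟨ zeroʳ e ⟨
      e * 0#            ∎))
    ... | inj₂ eyⁿ≈e = inj₂ (y ^ n-1 , annihilated (trans eyⁿ≈e (sym (*-identityʳ e))))

  -- From a = a ^ (n + 1) follows e = a w = e a ^ n, so e a = 0 would force e = 0. Starting the
  -- search at `a` thus keeps `a` nonzero in the factor.
  multiple-≉ : ∀ {e a w} → ¬ (e ≈ 0#) → e ≈ a * w → ¬ (_≈ₑ_ e a 0#)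
  multiple-≉ {e} {a} {w} e≉0 e≈aw (annihilated ea≈e0) = e≉0 (begin
    e                   ≈⟨ e≈aw ⟩
    a * w               ≈⟨ *-congʳ (powerIdentity a) ⟨
    (a * a ^ n) * w     ≈⟨ xy∙z≈xz∙y a (a ^ n) w ⟩
    (a * w) * a ^ n     ≈⟨ *-congʳ e≈aw ⟨
    e * (a * a ^ n-1)   ≈⟨ *-assoc e a _ ⟨
    (e * a) * a ^ n-1   ≈⟨ *-congʳ (trans ea≈e0 (zeroʳ e)) ⟩
    0# * a ^ n-1        ≈⟨ zeroˡ _ ⟩
    0#                  ∎)

  field-factor : ∀ ys → (∀ y → ∃ λ z → z ∈ ys × y ≈ z) → ∀ a → ¬ (a ≈ 0#) →
    ∃ λ e → IsField (quotientRing e) × ¬ (_≈ₑ_ e a 0#)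
  field-factor ys covered a a≉0 with splitting-multiple ys a a≉0
  ... | e , e≉0 , (w , e≈aw) , splits = e , quotient-isField e e≉0 splits′ , multiple-≉ e≉0 e≈aw
    where
    splits′ : ∀ y → Splits e y
    splits′ y with covered y
    ... | z , z∈ys , y≈z = splits-resp y≈z (All.lookup splits z∈ys)

module Separator {c ℓ} (R : CommutativeRing c ℓ) (p : ℕ) (x : CommutativeRing.Carrier R) where

  open CommutativeRing R
  open import Algebra.Properties.Semiring.Exp semiring using (_^_)

  -- Where this is invertible, x ^ pʲ ≉ x for 0 < j ≤ e.
  separator : ℕ → Carrier
  separator zero    = 1#
  separator (suc e) = separator e * (x ^ (p ℕ.^ suc e) - x)

  module _ (ε : Carrier) where
    open Annihilator R ε
    private module Q = CommutativeRing quotientRing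
    open import Algebra.Properties.Semiring.Exp Q.semiring using () renaming (_^_ to _^ₑ_)

    separator-vanishes : ∀ {i e} → i ℕ.< e → x ^ₑ (p ℕ.^ suc i) ≈ₑ x → separator e ≈ₑ 0#
    separator-vanishes {i} {suc e} i≤e xᵖ≈x with ℕ.m≤n⇒m<n∨m≡n i≤e
    ... | inj₁ (ℕ.s≤s i<e) = Q.trans (Q.*-congʳ (separator-vanishes i<e xᵖ≈x)) (Q.zeroˡ _)
    ... | inj₂ ≡.refl = Q.trans (Q.*-congˡ (Q.trans (Q.+-congʳ xᵖ≈x′) (Q.-‿inverseʳ x))) (Q.zeroʳ _)
      where
      xᵖ≈x′ : x ^ (p ℕ.^ suc i) ≈ₑ x
      xᵖ≈x′ = Q.trans (Q.reflexive (≡.sym (^ₑ≡^ x (p ℕ.^ suc i)))) xᵖ≈x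

-- Residues mod p and linear combinations over them

module Residues (p : ℕ) .{{_ : NonZero p}} where

  -- A record, so that x and y can be inferred from a proof of x ≋ y.
  infix 4 _≋_
  record _≋_ (x y : ℕ) : Set where
    constructor residue
    field residue-≡ : x % p ≡ y % p
  open _≋_ public

  ≡⇒≋ : ∀ {x y} → x ≡ y → x ≋ y
  ≡⇒≋ = residue ∘ ≡.cong (_% p)

  _≋?_ : Decidable _≋_
  x ≋? y = map′ residue residue-≡ (x % p ℕ.≟ y % p)

  ≋-+ : ∀ {x y u v} → x ≋ y → u ≋ v → x ℕ.+ u ≋ y ℕ.+ v
  ≋-+ {x} {y} {u} {v} (residue x≡y) (residue u≡v) = residue (≡.trans (%-distribˡ-+ x u p)
    (≡.trans (≡.cong₂ (λ i j → (i ℕ.+ j) % p) x≡y u≡v) (≡.sym (%-distribˡ-+ y v p))))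

  ≋-* : ∀ {x y u v} → x ≋ y → u ≋ v → x ℕ.* u ≋ y ℕ.* v
  ≋-* {x} {y} {u} {v} (residue x≡y) (residue u≡v) = residue (≡.trans (%-distribˡ-* x u p)
    (≡.trans (≡.cong₂ (λ i j → (i ℕ.* j) % p) x≡y u≡v) (≡.sym (%-distribˡ-* y v p))))

  neg : ℕ → ℕ
  neg x = ℕ.pred p ℕ.* x

  ≋-neg : ∀ x → x ℕ.+ neg x ≋ 0
  ≋-neg x = residue (≡.trans (≡.cong (λ n → (n ℕ.* x) % p) (ℕ.suc-pred p))
    (≡.trans (≡.cong (_% p) (ℕ.*-comm p x)) (≡.trans (m*n%n≡0 x p) (≡.sym (m*n%n≡0 0 p)))))

  residueRing : CommutativeRing 0ℓ 0ℓ
  residueRing = record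
    { Carrier = ℕ
    ; _≈_ = _≋_
    ; _+_ = ℕ._+_
    ; _*_ = ℕ._*_
    ; -_ = neg
    ; 0# = 0
    ; 1# = 1
    ; isCommutativeRing = record
      { isRing = record
        { +-isAbelianGroup = record
          { isGroup = record
            { isMonoid = record
              { isSemigroup = record
                { isMagma = record
                  { isEquivalence = record
                    { refl  = residue ≡.refl
                    ; sym   = residue ∘ ≡.sym ∘ residue-≡
                    ; trans = λ x≋y y≋z → residue (≡.trans (residue-≡ x≋y) (residue-≡ y≋z))
                    }
                  ; ∙-cong = ≋-+
                  }
                ; assoc = λ x y z → ≡⇒≋ (ℕ.+-assoc x y z)
                }
              ; identity = (λ x → ≡⇒≋ (ℕ.+-identityˡ x)) , (λ x → ≡⇒≋ (ℕ.+-identityʳ x))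
              }
            ; inverse = (λ x → residue (≡.trans (≡.cong (_% p) (ℕ.+-comm (neg x) x)) (residue-≡ (≋-neg x)))) , ≋-neg
            ; ⁻¹-cong = ≋-* {ℕ.pred p} (residue ≡.refl)
            }
          ; comm = λ x y → ≡⇒≋ (ℕ.+-comm x y)
          }
        ; *-cong = ≋-*
        ; *-assoc = λ x y z → ≡⇒≋ (ℕ.*-assoc x y z)
        ; *-identity = (λ x → ≡⇒≋ (ℕ.*-identityˡ x)) , (λ x → ≡⇒≋ (ℕ.*-identityʳ x))
        ; distrib = (λ x y z → ≡⇒≋ (ℕ.*-distribˡ-+ x y z)) , (λ x y z → ≡⇒≋ (ℕ.*-distribʳ-+ x y z))
        }
      ; *-comm = λ x y → ≡⇒≋ (ℕ.*-comm x y)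
      }
    }

module Combination {c ℓ} (K : CommutativeRing c ℓ) {p : ℕ} (prime : Prime p)
  (p·1≈0 : KilledBy p K) (x : CommutativeRing.Carrier K) where

  private instance
    p-nonZero : NonZero p
    p-nonZero = prime⇒nonZero prime

  open CommutativeRing K
  open Polynomial K
  open Characteristic K prime p·1≈0
  open import Algebra.Properties.Semiring.Mult semiring using (×-congˡ; ×-homo-+; ×1-homo-*)
    renaming (_×_ to _·_)
  open import Algebra.Properties.CommutativeSemiring.Exp commutativeSemiring using (_^_)
  open import Relation.Binary.Reasoning.Setoid setoid

  combination : ∀ {m} → (Fin m → ℕ) → Carrier
  combination f = eval (λ i → f i · 1#) x

  -- Coefficients are unreduced natural numbers, which makes closure under sums and multiples
  -- immediate; `spanned-%` reduces them mod p once, for finiteness.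
  Spanned : ℕ → Carrier → Set _
  Spanned m a = ∃ λ (f : Fin m → ℕ) → a ≈ combination f

  spanned-+ : ∀ {m a b} → Spanned m a → Spanned m b → Spanned m (a + b)
  spanned-+ (f , a≈f) (g , b≈g) = (λ i → f i ℕ.+ g i) , trans (+-cong a≈f b≈g)
    (trans (eval-+ (λ i → f i · 1#) (λ i → g i · 1#) x) (eval-cong (λ i → sym (×-homo-+ 1# (f i) (g i))) refl))

  spanned-· : ∀ {m a} d → Spanned m a → Spanned m ((d · 1#) * a)
  spanned-· d (f , a≈f) = (λ i → d ℕ.* f i) , trans (*-congˡ a≈f)
    (trans (eval-* (d · 1#) (λ i → f i · 1#) x) (eval-cong (λ i → sym (×1-homo-* d (f i))) refl))

  spanned-x* : ∀ {m a} → x ^ suc m ≈ 1# → Spanned (suc m) a → Spanned (suc m) (x * a)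
  spanned-x* {m} xᵐ⁺¹≈1 (f , a≈f) = rotate , trans (*-congˡ a≈f) (eval-rotate (λ i → f i · 1#) xᵐ⁺¹≈1)
    where
    rotate : Fin (suc m) → ℕ
    rotate fzero    = f (fromℕ _)
    rotate (fsuc i) = f (inject₁ i)

  spanned-1 : ∀ {m} → Spanned (suc m) 1#
  spanned-1 {m} = one , sym (trans (+-cong (+-identityʳ 1#) (trans (*-congˡ (eval-0 m x)) (zeroʳ x))) (+-identityʳ 1#))
    where
    one : Fin (suc m) → ℕ
    one fzero    = 1
    one (fsuc _) = 0

  spanned-resp : ∀ {m a b} → a ≈ b → Spanned m b → Spanned m a
  spanned-resp a≈b (f , b≈f) = f , trans a≈b b≈f

  ·1-% : ∀ c → c · 1# ≈ (c % p) · 1#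
  ·1-% c = begin
    c · 1#                                 ≈⟨ ×-congˡ (m≡m%n+[m/n]*n c p) ⟩
    (c % p ℕ.+ c / p ℕ.* p) · 1#           ≈⟨ ×-homo-+ 1# (c % p) (c / p ℕ.* p) ⟩
    (c % p) · 1# + (c / p ℕ.* p) · 1#      ≈⟨ +-congˡ (p∣⇒·≈0 (divides (c / p) ≡.refl) 1#) ⟩
    (c % p) · 1# + 0#                      ≈⟨ +-identityʳ _ ⟩
    (c % p) · 1#                           ∎

  spanned-% : ∀ {m a} → Spanned m a → ∃ λ (g : Fin m → Fin p) → a ≈ combination (toℕ ∘ g)
  spanned-% (f , a≈f) = (λ i → fromℕ< (m%n<n (f i) p)) , trans a≈f
    (eval-cong (λ i → trans (·1-% (f i)) (×-congˡ (≡.sym (Fin.toℕ-fromℕ< (m%n<n (f i) p))))) refl)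

  combinations : ℕ → List Carrier
  combinations m = map (λ i → combination (toℕ ∘ finToFun {p} {m} i)) (allFin (p ℕ.^ m))

  combinations-cover : ∀ {m y} → (∃ λ (f : Fin m → Fin p) → y ≈ combination (toℕ ∘ f)) →
    ∃ λ z → z ∈ combinations m × y ≈ z
  combinations-cover {m} {y} (f , y≈f) =
    combination (toℕ ∘ finToFun {p} {m} (funToFin f)) ,
    ∈-map⁺ (λ i → combination (toℕ ∘ finToFun {p} {m} i)) (∈-allFin (funToFin f)) ,
    trans y≈f (eval-cong (λ i → ×-congˡ (≡.cong toℕ (≡.sym (Fin.finToFun-funToFin f i)))) refl)

-- The group algebra of a cyclic group of order q - 1

separatorDegree : ℕ → ℕ → ℕ
separatorDegree p zero    = 0
separatorDegree p (suc e) = separatorDegree p e ℕ.+ p ℕ.^ suc e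

separatorDegree-bound : ∀ {p} → 1 < p → ∀ e → separatorDegree p e ℕ.+ 2 ≤ p ℕ.^ suc e
separatorDegree-bound {p} 1<p zero    = ℕ.≤-trans 1<p (ℕ.≤-reflexive (≡.sym (ℕ.*-identityʳ p)))
separatorDegree-bound {p} 1<p (suc e) = begin
  (d ℕ.+ P) ℕ.+ 2   ≡⟨ xy∙z≈xz∙y d P 2 ⟩
  (d ℕ.+ 2) ℕ.+ P   ≤⟨ ℕ.+-monoˡ-≤ P (separatorDegree-bound 1<p e) ⟩
  P ℕ.+ P           ≡⟨ ≡.cong (P ℕ.+_) (ℕ.+-identityʳ P) ⟨
  2 ℕ.* P           ≤⟨ ℕ.*-monoˡ-≤ P 1<p ⟩
  p ℕ.* P           ∎
  where
  open import Algebra.Properties.CommutativeSemigroup ℕ.+-commutativeSemigroup using (xy∙z≈xz∙y)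
  open ℕ.≤-Reasoning
  d = separatorDegree p e
  P = p ℕ.^ suc e

-- The ring F_p[X] / (Xⁿ - 1) with n + 1 = p ^ (e + 1).
module GroupAlgebra {p} (prime : Prime p) (e n-1 : ℕ) (q≡ : p ℕ.^ suc e ≡ suc (suc n-1)) where

  private instance
    p-nonZero : NonZero p
    p-nonZero = prime⇒nonZero prime

  open Residues p
  open ShiftOperators residueRing public

  n q : ℕ
  n = suc n-1
  q = suc n

  1<p : 1 < p
  1<p = ℕ.nonTrivial⇒n>1 p {{prime⇒nonTrivial prime}}

  1≇0 : ¬ (1 ≋ 0)
  1≇0 (residue eq) = ℕ.1+n≢0 (≡.trans (≡.sym (m<n⇒m%n≡m 1<p)) (≡.trans eq (m*n%n≡0 0 p)))

  -- The first 1 stands at position n - 1, after the longest run of zeros that a nonzero sequence of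
  -- period n can have; no monic operator of degree below n annihilates it.
  impulse : Sequence
  impulse m = if does (suc m % n ℕ.≟ 0) then 1 else 0

  impulse-period : ∀ m → impulse (n ℕ.+ m) ≋ impulse m
  impulse-period m = ≡⇒≋ (≡.cong (λ j → if does (j ℕ.≟ 0) then 1 else 0)
    (≡.trans (≡.cong (λ j → suc j % n) (ℕ.+-comm n m)) ([m+n]%n≡m%n (suc m) n)))

  impulse-last : impulse n-1 ≡ 1
  impulse-last rewrite n%n≡0 n {{_}} = ≡.refl

  impulse-zero : ∀ m → m < n-1 → impulse m ≡ 0
  impulse-zero m m<n-1 rewrite m<n⇒m%n≡m {{_}} (s≤s m<n-1) = ≡.refl

  R : CommutativeRing 0ℓ 0ℓ
  R = operatorRing impulse

  open CommutativeRing R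
  open Periodic impulse-period _≋?_ public
  open import Algebra.Properties.Semiring.Mult semiring using () renaming (_×_ to _·_)
  open import Algebra.Properties.CommutativeSemiring.Exp commutativeSemiring
    using (_^_; ^-congʳ; ^-congˡ; ^-distrib-*)
  open import Relation.Binary.Reasoning.Setoid setoid

  const≈ : ∀ c → const c ≈ c · 1#
  const≈ zero    = refl
  const≈ (suc c) = trans (agree λ m → Fp.distribʳ (impulse m) 1 c) (+-congˡ (const≈ c))
    where module Fp = CommutativeRing residueRing

  p·1≈0 : KilledBy p R
  p·1≈0 = trans (sym (const≈ p)) (agree λ m → ≋-* p≋0 (≡⇒≋ {impulse m} ≡.refl))
    where
    p≋0 : p ≋ 0
    p≋0 = residue (≡.trans (n%n≡0 p) (≡.sym (m*n%n≡0 0 p)))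

  open Characteristic R prime p·1≈0
  open Combination R prime p·1≈0 X public
  open Separator R p X public

  -- Raising to a power of p is a ring endomorphism in characteristic p, so it is enough that
  -- constants and `X` are fixed.
  ^q : ∀ a → a ^ q ≈ a
  ^q a = ≡.subst (λ j → a ^ j ≈ a) q≡ (go a)
    where
    go : ∀ a → a ^ (p ℕ.^ suc e) ≈ a
    go (const c) = begin
      const c ^ (p ℕ.^ suc e)    ≈⟨ ^-congˡ (p ℕ.^ suc e) (const≈ c) ⟩
      (c · 1#) ^ (p ℕ.^ suc e)   ≈⟨ ^p^-·1 (suc e) c ⟩
      c · 1#                     ≈⟨ const≈ c ⟨
      const c                    ∎
    go X = begin
      X ^ (p ℕ.^ suc e)   ≈⟨ ^-congʳ X q≡ ⟩
      X * X ^ n           ≈⟨ *-congˡ X^n≈1 ⟩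
      X * 1#              ≈⟨ *-identityʳ X ⟩
      X                   ∎
    go (a ⊕ b) = trans (^p^-+ (suc e) a b) (+-cong (go a) (go b))
    go (a ⊗ b) = trans (^-distrib-* a b (p ℕ.^ suc e)) (*-cong (go a) (go b))

  -- The span of 1, X, ..., X ^ (n - 1) is an ideal, and it contains 1, so it is all of R. Stated as
  -- an action on the span, the case of a product is mere composition.
  spanned-⊗ : ∀ a {b} → Spanned n b → Spanned n (a ⊗ b)
  spanned-⊗ (const c)    b∈ = spanned-resp (*-congʳ (const≈ c)) (spanned-· c b∈)
  spanned-⊗ X            b∈ = spanned-x* X^n≈1 b∈
  spanned-⊗ (a ⊕ a′) {b} b∈ = spanned-resp (distribʳ b a a′) (spanned-+ (spanned-⊗ a b∈) (spanned-⊗ a′ b∈))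
  spanned-⊗ (a ⊗ a′) {b} b∈ = spanned-resp (*-assoc a a′ b) (spanned-⊗ a (spanned-⊗ a′ b∈))

  finitely-covered : ∀ a → ∃ λ (f : Fin n → Fin p) → a ≈ combination (toℕ ∘ f)
  finitely-covered a = spanned-% (spanned-resp (sym (*-identityʳ a)) (spanned-⊗ a spanned-1))

  separator-monic : ∀ j → Monic (separatorDegree p j) (separator j)
  separator-monic zero    = monic-1
  separator-monic (suc j) = monic-⊗ {a = separator j} {b = X ^ (p ℕ.^ suc j) - X} (separator-monic j) monic-factor
    where
    module F = CommutativeRing residueRing
    -- Index 1 lies inside the window of p ^ (j + 1) zeros, so the term - X contributes nothing.
    1<p^ : 1 < p ℕ.^ suc j
    1<p^ = ℕ.≤-trans 1<p (ℕ.m≤m*n p (p ℕ.^ j) {{ℕ.m^n≢0 p j}})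
    monic-factor : Monic (p ℕ.^ suc j) (X ^ (p ℕ.^ suc j) - X)
    monic-factor t m zeros = F.trans
      (F.+-cong (F.trans (⟦X^_⟧ impulse (p ℕ.^ suc j) t m) (≡⇒≋ (≡.cong t (ℕ.+-comm _ m))))
        (F.trans (F.*-congˡ {neg 1} (F.trans (≡⇒≋ (≡.cong t (ℕ.+-comm 1 m))) (zeros 1 1<p^))) (F.zeroʳ (neg 1))))
      (F.+-identityʳ _)

  -- With d the degree of the separator, the d positions from n - 1 - d on hold zeros and the 1 of
  -- `impulse` comes next, so the separator reads 1 at n - 1 - d.
  separator≉0 : ¬ (separator e ≈ 0#)
  separator≉0 sep≈0 = 1≇0 (F.trans (F.sym last≋1) (at sep≈0 m))
    where
    module F = CommutativeRing residueRing
    d≤n-1 : separatorDegree p e ≤ n-1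
    d≤n-1 = ℕ.+-cancelʳ-≤ 2 _ _ (ℕ.≤-trans (separatorDegree-bound 1<p e) (ℕ.≤-reflexive (≡.trans q≡ (ℕ.+-comm 2 n-1))))
    m = n-1 ∸ separatorDegree p e
    m+d≡ : m ℕ.+ separatorDegree p e ≡ n-1
    m+d≡ = ℕ.m∸n+n≡m d≤n-1
    last≋1 : ⟦ separator e ⟧ impulse m ≋ 1
    last≋1 = F.trans (separator-monic e impulse m (λ i i<d → ≡⇒≋ (impulse-zero (m ℕ.+ i)
        (ℕ.<-≤-trans (ℕ.+-monoʳ-< m i<d) (ℕ.≤-reflexive m+d≡)))))
      (≡⇒≋ (≡.trans (≡.cong impulse m+d≡) impulse-last))

-- A field with separated conjugates, and its size

Separated : ∀ {c ℓ} (K : CommutativeRing c ℓ) → ℕ → ℕ → CommutativeRing.Carrier K → Set ℓ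
Separated K p e x = ∀ j → 0 < j → j ≤ e → ¬ (x ^ (p ℕ.^ j)) ≈ x
  where
  open CommutativeRing K
  open import Algebra.Properties.Semiring.Exp semiring using (_^_)

record SeparatedField (p e q : ℕ) : Set₁ where
  field
    ring          : CommutativeRing 0ℓ 0ℓ
    _≟_           : Decidable (CommutativeRing._≈_ ring)
    isField       : IsField ring
    killedBy      : KilledBy p ring
    powerIdentity : PowerIdentity q ring
    generator     : CommutativeRing.Carrier ring
    separated     : Separated ring p e generator

separatedQuotient : (R : CommutativeRing 0ℓ 0ℓ) → Decidable (CommutativeRing._≈_ R) → ∀ {p e n-1} →
  KilledBy p R → PowerIdentity (suc (suc n-1)) R →
  ∀ ys → (∀ y → ∃ λ z → z ∈ ys × CommutativeRing._≈_ R y z) →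
  ∀ x → ¬ (CommutativeRing._≈_ R (Separator.separator R p x e) (CommutativeRing.0# R)) →
  SeparatedField p e (suc (suc n-1))
separatedQuotient R _≟_ {p} {e} {n-1} p·1≈0 powerIdentity ys covered x separator≉0
  with FieldFactor.field-factor R _≟_ n-1 powerIdentity ys covered (Separator.separator R p x e) separator≉0
... | ε , isField , separator≉ₑ0 = record
  { ring          = quotientRing ε
  ; _≟_           = ≈ₑ-decidable ε _≟_
  ; isField       = isField
  ; killedBy      = quotient-killedBy ε p p·1≈0
  ; powerIdentity = λ y → quotient-^ ε y (suc (suc n-1)) (powerIdentity y)
  ; generator     = x
  ; separated     = λ where
      (suc i) _ i<e xᵖ≈x → separator≉ₑ0 (Separator.separator-vanishes R p x ε i<e xᵖ≈x)
  }
  where open Annihilator R using (quotientRing; ≈ₑ-decidable; quotient-killedBy; quotient-^)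

separatedField : ∀ {p} → Prime p → ∀ e n-1 → p ℕ.^ suc e ≡ suc (suc n-1) →
  SeparatedField p e (suc (suc n-1))
separatedField pr e n-1 q≡ = separatedQuotient R _≟ᴿ_ p·1≈0 ^q
  (combinations n) (λ y → combinations-cover (finitely-covered y)) X separator≉0
  where open GroupAlgebra pr e n-1 q≡

funToFin-cong : ∀ {m n} {f g : Fin m → Fin n} → (∀ i → f i ≡ g i) → funToFin f ≡ funToFin g
funToFin-cong {zero}  f≗g = ≡.refl
funToFin-cong {suc m} f≗g = ≡.cong₂ combine (f≗g fzero) (funToFin-cong (f≗g ∘ fsuc))

finToFun-injective : ∀ {m n} (i j : Fin (n ℕ.^ m)) → (∀ k → finToFun {n} {m} i k ≡ finToFun {n} {m} j k) → i ≡ j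
finToFun-injective {m} {n} i j eq = ≡.trans (≡.sym (Fin.funToFin-finToFin {m} {n} i))
  (≡.trans (funToFin-cong eq) (Fin.funToFin-finToFin {m} {n} j))

module Conjugates {c ℓ} (K : CommutativeRing c ℓ) (isField : IsField K) {p e} (prime : Prime p)
  (p·1≈0 : KilledBy p K) (powerIdentity : PowerIdentity (p ℕ.^ suc e) K)
  (x : CommutativeRing.Carrier K) (separated : Separated K p e x) where

  private instance
    p-nonZero : NonZero p
    p-nonZero = prime⇒nonZero prime

  open CommutativeRing K
  open Polynomial K
  open Field K isField
  open Characteristic K prime p·1≈0
  open Combination K prime p·1≈0 x
  open import Algebra.Properties.Group +-group using (∙-cancelʳ)
  open import Algebra.Properties.Semiring.Mult semiring using (×-congˡ; ×-homo-+; ×1-homo-*) renaming (_×_ to _·_)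
  open import Algebra.Properties.CommutativeSemiring.Exp commutativeSemiring
    using (_^_; ^-congˡ; ^-congʳ; ^-assocʳ; ^-distrib-*)
  open import Relation.Binary.Reasoning.Setoid setoid

  *-·1≈0 : ∀ m {d} → d · 1# ≈ 0# → (m ℕ.* d) · 1# ≈ 0#
  *-·1≈0 m {d} d·1≈0 = trans (×1-homo-* m d) (trans (*-congˡ d·1≈0) (zeroʳ (m · 1#)))

  consecutive-·1≉0 : ∀ {a b} → suc a ≡ b → a · 1# ≈ 0# → ¬ (b · 1# ≈ 0#)
  consecutive-·1≉0 ≡.refl a·1≈0 b·1≈0 =
    1≉0 (trans (sym (+-identityʳ 1#)) (trans (+-congˡ (sym a·1≈0)) b·1≈0))

  -- The unsigned Bézout identity exhibits consecutive multiples of p and r; if both vanished in K,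
  -- so would 1.
  bézout-·1≉0 : ∀ {r} → Bézout.Identity 1 p r → ¬ (r · 1# ≈ 0#)
  bézout-·1≉0 (Bézout.Identity.+- u v eq) r·1≈0 = consecutive-·1≉0 eq (*-·1≈0 v r·1≈0) (*-·1≈0 u p·1≈0)
  bézout-·1≉0 (Bézout.Identity.-+ u v eq) r·1≈0 = consecutive-·1≉0 eq (*-·1≈0 u p·1≈0) (*-·1≈0 v r·1≈0)

  ·1≈0⇒∣ : ∀ d → d · 1# ≈ 0# → p ∣ d
  ·1≈0⇒∣ d d·1≈0 with d % p in d%p≡
  ... | zero  = m%n≡0⇒n∣m d p d%p≡
  ... | suc r = ⊥-elim (bézout-·1≉0 (coprime-Bézout (prime⇒coprime prime (≡.subst (_< p) d%p≡ (m%n<n d p))))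
      (trans (×-congˡ (≡.sym d%p≡)) (trans (sym (·1-% d)) d·1≈0)))

  ·1-injective-≤ : ∀ {a b} → a ≤ b → b < p → a · 1# ≈ b · 1# → a ≡ b
  ·1-injective-≤ {a} {b} a≤b b<p a≈b with b ∸ a in b∸a≡
  ... | zero  = ℕ.≤-antisym a≤b (ℕ.m∸n≡0⇒m≤n b∸a≡)
  ... | suc r = ⊥-elim (ℕ.<⇒≱ b<p (ℕ.≤-trans (∣⇒≤ (·1≈0⇒∣ (suc r) r·1≈0))
      (ℕ.≤-trans (ℕ.≤-reflexive (≡.sym b∸a≡)) (ℕ.m∸n≤m b a))))
    where
    r·1≈0 : suc r · 1# ≈ 0#
    r·1≈0 = ∙-cancelʳ (a · 1#) _ _ (begin
      suc r · 1# + a · 1#    ≈⟨ ×-homo-+ 1# (suc r) a ⟨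
      (suc r ℕ.+ a) · 1#     ≈⟨ ×-congˡ (≡.trans (≡.cong (ℕ._+ a) (≡.sym b∸a≡)) (ℕ.m∸n+n≡m a≤b)) ⟩
      b · 1#                 ≈⟨ a≈b ⟨
      a · 1#                 ≈⟨ +-identityˡ _ ⟨
      0# + a · 1#            ∎)

  ·1-injective : ∀ {i j : Fin p} → toℕ i · 1# ≈ toℕ j · 1# → i ≡ j
  ·1-injective {i} {j} i≈j with ℕ.≤-total (toℕ i) (toℕ j)
  ... | inj₁ i≤j = Fin.toℕ-injective (·1-injective-≤ i≤j (Fin.toℕ<n j) i≈j)
  ... | inj₂ j≤i = Fin.toℕ-injective (≡.sym (·1-injective-≤ j≤i (Fin.toℕ<n i) (sym i≈j)))

  conjugate : Fin (suc e) → Carrier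
  conjugate i = x ^ (p ℕ.^ toℕ i)

  -- Raising to the power p ^ (e + 1 - i) turns the hypothesis into x ≈ x ^ p ^ (j - i).
  conjugate-≉ : ∀ {i j} → i < j → j ≤ e → ¬ (x ^ (p ℕ.^ i) ≈ x ^ (p ℕ.^ j))
  conjugate-≉ {i} {j} i<j j≤e xⁱ≈xʲ = separated (j ∸ i) (ℕ.m<n⇒0<n∸m i<j) (ℕ.≤-trans (ℕ.m∸n≤m j i) j≤e) (begin
    x ^ (p ℕ.^ d)                           ≈⟨ ^-congˡ (p ℕ.^ d) (powerIdentity x) ⟨
    (x ^ (p ℕ.^ suc e)) ^ (p ℕ.^ d)         ≈⟨ ^p^-assoc (suc e) d ⟩
    x ^ (p ℕ.^ (suc e ℕ.+ d))               ≈⟨ ^-congʳ x (≡.cong (p ℕ.^_) k+d≡j+k-i) ⟩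
    x ^ (p ℕ.^ (j ℕ.+ (suc e ∸ i)))         ≈⟨ ^p^-assoc j (suc e ∸ i) ⟨
    (x ^ (p ℕ.^ j)) ^ (p ℕ.^ (suc e ∸ i))   ≈⟨ ^-congˡ (p ℕ.^ (suc e ∸ i)) xⁱ≈xʲ ⟨
    (x ^ (p ℕ.^ i)) ^ (p ℕ.^ (suc e ∸ i))   ≈⟨ ^p^-assoc i (suc e ∸ i) ⟩
    x ^ (p ℕ.^ (i ℕ.+ (suc e ∸ i)))         ≈⟨ ^-congʳ x (≡.cong (p ℕ.^_) (ℕ.m+[n∸m]≡n i≤k)) ⟩
    x ^ (p ℕ.^ suc e)                       ≈⟨ powerIdentity x ⟩
    x                                       ∎)
    where
    d = j ∸ i
    i≤k : i ≤ suc e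
    i≤k = ℕ.≤-trans (ℕ.<⇒≤ i<j) (ℕ.m≤n⇒m≤1+n j≤e)
    ^p^-assoc : ∀ a b → (x ^ (p ℕ.^ a)) ^ (p ℕ.^ b) ≈ x ^ (p ℕ.^ (a ℕ.+ b))
    ^p^-assoc a b = trans (^-assocʳ x (p ℕ.^ a) (p ℕ.^ b)) (^-congʳ x (≡.sym (ℕ.^-distribˡ-+-* p a b)))
    k+d≡j+k-i : suc e ℕ.+ d ≡ j ℕ.+ (suc e ∸ i)
    k+d≡j+k-i = ≡.trans (≡.sym (ℕ.+-∸-assoc (suc e) (ℕ.<⇒≤ i<j)))
      (≡.trans (≡.cong (_∸ i) (ℕ.+-comm (suc e) j)) (ℕ.+-∸-assoc j i≤k))

  conjugate-injective : ∀ {i j} → conjugate i ≈ conjugate j → i ≡ j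
  conjugate-injective {i} {j} eq with ℕ.<-cmp (toℕ i) (toℕ j)
  ... | tri< i<j _ _ = ⊥-elim (conjugate-≉ i<j (Fin.toℕ≤pred[n] j) eq)
  ... | tri≈ _ i≡j _ = Fin.toℕ-injective i≡j
  ... | tri> _ _ j<i = ⊥-elim (conjugate-≉ j<i (Fin.toℕ≤pred[n] i) (sym eq))

  -- Frobenius fixes multiples of 1, hence the coefficients, and moves only the argument. An
  -- equality of combinations at `x` thus spreads to all conjugates of `x`.
  eval-frobenius : ∀ j {m} (f : Fin m → ℕ) t →
    eval (λ i → f i · 1#) t ^ (p ℕ.^ j) ≈ eval (λ i → f i · 1#) (t ^ (p ℕ.^ j))
  eval-frobenius j {zero}  f t = 0^p^ j
  eval-frobenius j {suc m} f t = begin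
    (f fzero · 1# + t * u) ^ P        ≈⟨ ^p^-+ j _ _ ⟩
    (f fzero · 1#) ^ P + (t * u) ^ P  ≈⟨ +-cong (^p^-·1 j (f fzero)) (^-distrib-* t u P) ⟩
    f fzero · 1# + t ^ P * u ^ P      ≈⟨ +-congˡ (*-congˡ (eval-frobenius j (f ∘ fsuc) t)) ⟩
    f fzero · 1# + t ^ P * eval (λ i → f (fsuc i) · 1#) (t ^ P) ∎
    where
    P = p ℕ.^ j
    u = eval (λ i → f (fsuc i) · 1#) t

  combination-injective : ∀ (f g : Fin (suc e) → Fin p) →
    combination (toℕ ∘ f) ≈ combination (toℕ ∘ g) → ∀ i → f i ≡ g i
  combination-injective f g eq i = ·1-injective (eval-injective (λ i → toℕ (f i) · 1#) (λ i → toℕ (g i) · 1#)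
    conjugate conjugate-injective agree i)
    where
    agree : ∀ i → eval (λ j → toℕ (f j) · 1#) (conjugate i) ≈ eval (λ j → toℕ (g j) · 1#) (conjugate i)
    agree i = trans (sym (eval-frobenius (toℕ i) (toℕ ∘ f) x))
      (trans (^-congˡ (p ℕ.^ toℕ i) eq) (eval-frobenius (toℕ i) (toℕ ∘ g) x))

  element : Fin (p ℕ.^ suc e) → Carrier
  element i = combination (toℕ ∘ finToFun {p} {suc e} i)

  element-injective : ∀ {i j} → element i ≈ element j → i ≡ j
  element-injective {i} {j} eq = finToFun-injective i j
    (combination-injective (finToFun {p} {suc e} i) (finToFun {p} {suc e} j) eq)

module Saturation {c ℓ} (K : CommutativeRing c ℓ) (isField : IsField K) where

  open CommutativeRing K
  open Polynomial K
  open Field K isField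

  -- Otherwise X ^ q - X would have q + 1 roots.
  injective⇒surjective : ∀ n-1 → let q = suc (suc n-1) in PowerIdentity q K → Decidable _≈_ →
    (f : Fin q → Carrier) → (∀ {i j} → f i ≈ f j → i ≡ j) → ∀ y → ∃ λ i → f i ≈ y
  injective⇒surjective n-1 powerIdentity _≟_ f f-injective y with Fin.any? (λ i → f i ≟ y)
  ... | yes found = found
  -- X ^ q and X, as vectors of q + 1 coefficients, agree at q + 1 points; their entries at q are 1
  -- and, because q is at least 2, 0.
  ... | no ¬found = ⊥-elim (1≉0 (trans (sym (monomial-diag (fromℕ q)))
          (eval-injective (monomial (fromℕ q)) (monomial 1F) points points-injective agree (fromℕ q))))
    where
    open import Algebra.Properties.Semiring.Exp semiring using (^-congʳ)
    q = suc (suc n-1)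
    1F : Fin (suc q)
    1F = fsuc fzero
    points : Fin (suc q) → Carrier
    points fzero    = y
    points (fsuc i) = f i
    points-injective : ∀ {i j} → points i ≈ points j → i ≡ j
    points-injective {fzero}  {fzero}  _  = ≡.refl
    points-injective {fzero}  {fsuc j} eq = ⊥-elim (¬found (j , sym eq))
    points-injective {fsuc i} {fzero}  eq = ⊥-elim (¬found (i , eq))
    points-injective {fsuc i} {fsuc j} eq = ≡.cong fsuc (f-injective eq)
    agree : ∀ i → eval (monomial (fromℕ q)) (points i) ≈ eval (monomial 1F) (points i)
    agree i = trans (eval-monomial (fromℕ q) z) (trans (^-congʳ z (Fin.toℕ-fromℕ q))
      (trans (powerIdentity z) (trans (sym (*-identityʳ z)) (sym (eval-monomial 1F z)))))
      where z = points i

-- Agreements and Hamming distance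

length-filter-¬ : ∀ {a ℓ} {A : Set a} {P : A → Set ℓ} (P? : Decidable₁ P) (xs : List A) →
  length (filter P? xs) ℕ.+ length (filter (¬? ∘ P?) xs) ≡ length xs
length-filter-¬ P? [] = ≡.refl
length-filter-¬ P? (x ∷ xs) with P? x
... | yes _ = ≡.cong suc (length-filter-¬ P? xs)
... | no  _ = ≡.trans (ℕ.+-suc _ _) (≡.cong suc (length-filter-¬ P? xs))

lookup-injective : ∀ {a} {A : Set a} {xs : List A} → Unique xs → ∀ {i j} → lookup xs i ≡ lookup xs j → i ≡ j
lookup-injective {xs = _ ∷ _} (_ ∷ _)       {fzero}  {fzero}  _  = ≡.refl
lookup-injective {xs = _ ∷ _} (x∉xs ∷ _)    {fzero}  {fsuc j} eq = ⊥-elim (All.lookup x∉xs (∈-lookup j) eq)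
lookup-injective {xs = _ ∷ _} (x∉xs ∷ _)    {fsuc i} {fzero}  eq = ⊥-elim (All.lookup x∉xs (∈-lookup i) (≡.sym eq))
lookup-injective {xs = _ ∷ _} (_ ∷ unique)  {fsuc i} {fsuc j} eq = ≡.cong fsuc (lookup-injective unique eq)

-- Agreements and disagreements add up to m. The hypothesis speaks of d + 1 distinct points, the
-- form in which interpolation refutes them; d + 1 entries of an overlong list of agreements would
-- supply such points.
hamming-≥ : ∀ {m} d (π σ : Permutation′ m) →
  (∀ (r : Fin (suc d) → Fin m) → (∀ {i j} → r i ≡ r j → i ≡ j) → ¬ (∀ i → π ⟨$⟩ʳ r i ≡ σ ⟨$⟩ʳ r i)) →
  m ∸ d ≤ hamming π σ
hamming-≥ {m} d π σ few-agreements = ℕ.m≤n+o⇒m∸n≤o m d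
    (ℕ.≤-trans (ℕ.≤-reflexive (≡.sym total)) (ℕ.+-monoˡ-≤ (hamming π σ) agreements≤d))
  where
  agree? : Decidable₁ (λ i → π ⟨$⟩ʳ i ≡ σ ⟨$⟩ʳ i)
  agree? i = (π ⟨$⟩ʳ i) Fin.≟ (σ ⟨$⟩ʳ i)
  agreements = filter agree? (allFin m)
  total : length agreements ℕ.+ hamming π σ ≡ m
  total = ≡.trans (length-filter-¬ agree? (allFin m)) (length-tabulate id)
  agreements≤d : length agreements ≤ d
  agreements≤d with length agreements ℕ.≤? d
  ... | yes ≤d = ≤d
  ... | no  ≰d = ⊥-elim (few-agreements (λ i → lookup agreements (inject≤ i d<))
      (λ eq → Fin.inject≤-injective d< d< _ _ (lookup-injective (Unique.filter⁺ agree? (Unique.allFin⁺ m)) eq))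
      (λ i → All.lookup (all-filter agree? (allFin m)) (∈-lookup (inject≤ i d<))))
    where d< = ℕ.≰⇒> ≰d

-- Permutation polynomials of degree at most 3 and their code

module CubicCode (K : CommutativeRing 0ℓ 0ℓ) (isField : IsField K) (n-1 : ℕ)
  (powerIdentity : PowerIdentity (suc (suc n-1)) K) (3≉0 : ¬ KilledBy 3 K)
  (q%3≡2 : suc (suc n-1) % 3 ≡ 2)
  (θ : Fin (suc (suc n-1)) → CommutativeRing.Carrier K)
  (θ-injective : ∀ {i j} → CommutativeRing._≈_ K (θ i) (θ j) → i ≡ j)
  (surjective : ∀ (f : Fin (suc (suc n-1)) → CommutativeRing.Carrier K) →
    (∀ {i j} → CommutativeRing._≈_ K (f i) (f j) → i ≡ j) → ∀ y → ∃ λ i → CommutativeRing._≈_ K (f i) y)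
  where

  open CommutativeRing K
  open Polynomial K using (eval)
  open Field K isField
  open import Algebra.Properties.Group +-group using (∙-cancelʳ)
  open import Algebra.Properties.Semiring.Mult semiring using () renaming (_×_ to _·_)
  open import Algebra.Properties.CommutativeSemiring.Exp commutativeSemiring
    using (_^_; ^-congˡ; ^-congʳ; ^-assocʳ; ^-homo-*)
  open import Algebra.Solver.Ring.NaturalCoefficients.Default commutativeSemiring
    using (solve; _:=_; _:+_; _:*_; con; Polynomial)
  open import Relation.Binary.Reasoning.Setoid setoid

  private
    n = suc n-1
    q = suc n

  θ⁻¹ : Carrier → Fin q
  θ⁻¹ y = proj₁ (surjective θ θ-injective y)

  θ-θ⁻¹ : ∀ y → θ (θ⁻¹ y) ≈ y
  θ-θ⁻¹ y = proj₂ (surjective θ θ-injective y)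

  -- The inverse needs no formula: `f ∘ θ` is again an injection from `Fin q`, so `surjective`
  -- supplies preimages.
  induced : (f : Carrier → Carrier) → (∀ {x y} → f x ≈ f y → x ≈ y) → Permutation′ q
  induced f f-injective = permutation to from to-from (λ i → to-injective (to-from (to i)))
    where
    f∘θ-injective : ∀ {i j} → f (θ i) ≈ f (θ j) → i ≡ j
    f∘θ-injective = θ-injective ∘ f-injective
    to from : Fin q → Fin q
    to i = θ⁻¹ (f (θ i))
    from j = proj₁ (surjective (f ∘ θ) f∘θ-injective (θ j))
    θ-to : ∀ i → θ (to i) ≈ f (θ i)
    θ-to i = θ-θ⁻¹ (f (θ i))
    to-from : ∀ j → to (from j) ≡ j
    to-from j = θ-injective (trans (θ-to (from j)) (proj₂ (surjective (f ∘ θ) f∘θ-injective (θ j))))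
    to-injective : ∀ {i j} → to i ≡ to j → i ≡ j
    to-injective {i} {j} eq = f∘θ-injective (trans (sym (θ-to i)) (trans (reflexive (≡.cong θ eq)) (θ-to j)))

  -- 3 divides q + (q - 1), and x ^ (q + (q - 1)) ≈ x.
  cube-injective : ∀ {x y} → x ^ 3 ≈ y ^ 3 → x ≈ y
  cube-injective {x} {y} x³≈y³ = begin
    x               ≈⟨ cube-root x ⟨
    (x ^ 3) ^ N     ≈⟨ ^-congˡ N x³≈y³ ⟩
    (y ^ 3) ^ N     ≈⟨ cube-root y ⟩
    y               ∎
    where
    t = q / 3
    -- With q = 3 t + 2, the exponent 2 q - 1 is 6 t + 3 = 3 (2 t + 1).
    N = 1 ℕ.+ 2 ℕ.* t
    q≡2+t*3 : q ≡ 2 ℕ.+ t ℕ.* 3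
    q≡2+t*3 = ≡.trans (m≡m%n+[m/n]*n q 3) (≡.cong (ℕ._+ t ℕ.* 3) q%3≡2)
    3N≡q+n : 3 ℕ.* N ≡ q ℕ.+ n
    3N≡q+n = ≡.trans (solveℕ 1 (λ s → conℕ 3 :*ℕ (conℕ 1 :+ℕ conℕ 2 :*ℕ s) :=ℕ
        (conℕ 2 :+ℕ s :*ℕ conℕ 3) :+ℕ (conℕ 1 :+ℕ s :*ℕ conℕ 3)) ≡.refl t)
      (≡.sym (≡.cong₂ ℕ._+_ q≡2+t*3 (ℕ.suc-injective q≡2+t*3)))
      where open import Data.Nat.Solver using (module +-*-Solver)
            open +-*-Solver using () renaming (solve to solveℕ; _:*_ to _:*ℕ_; _:+_ to _:+ℕ_; _:=_ to _:=ℕ_; con to conℕ)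
    cube-root : ∀ z → (z ^ 3) ^ N ≈ z
    cube-root z = begin
      (z ^ 3) ^ N       ≈⟨ ^-assocʳ z 3 N ⟩
      z ^ (3 ℕ.* N)     ≈⟨ ^-congʳ z 3N≡q+n ⟩
      z ^ (q ℕ.+ n)     ≈⟨ ^-homo-* z q n ⟩
      z ^ q * z ^ n     ≈⟨ *-congʳ (powerIdentity z) ⟩
      z * z ^ n         ≈⟨ powerIdentity z ⟩
      z                 ∎

  linear : Carrier → Carrier → Fin 4 → Carrier
  linear a b fzero            = b
  linear a b (fsuc fzero)     = a
  linear a b (fsuc (fsuc _))  = 0#

  -- a (X + c)³ + b
  cubic : Carrier → Carrier → Carrier → Fin 4 → Carrier
  cubic a b c fzero                       = b + a * c ^ 3
  cubic a b c (fsuc fzero)                = (3 · 1#) * (a * (c * c))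
  cubic a b c (fsuc (fsuc fzero))         = (3 · 1#) * (a * c)
  cubic a b c (fsuc (fsuc (fsuc fzero)))  = a

  eval-linear : ∀ a b x → eval (linear a b) x ≈ a * x + b
  eval-linear a b x = solve 3 (λ a b x →
    b :+ x :* (a :+ x :* (con 0 :+ x :* (con 0 :+ x :* con 0))) := a :* x :+ b) refl a b x

  eval-cubic : ∀ a b c x → eval (cubic a b c) x ≈ a * (x + c) ^ 3 + b
  eval-cubic a b c x = solve 4 (λ a b c x →
      (b :+ a :* (c :* (c :* (c :* con 1)))) :+ x :* (three :* (a :* (c :* c)) :+ x :* (three :* (a :* c) :+ x :* (a :+ x :* con 0)))
      := a :* ((x :+ c) :* ((x :+ c) :* ((x :+ c) :* con 1))) :+ b) refl a b c x
    where
    -- This spells out how `3 · 1#` unfolds, so that the solved equation matches the coefficients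
    -- definitionally.
    three : ∀ {m} → Polynomial m
    three = con 1 :+ (con 1 :+ (con 1 :+ con 0))

  linear-injective : ∀ {a b} → ¬ (a ≈ 0#) → ∀ {x y} → eval (linear a b) x ≈ eval (linear a b) y → x ≈ y
  linear-injective {a} {b} a≉0 eq =
    *-cancelˡ a≉0 (∙-cancelʳ b _ _ (trans (sym (eval-linear a b _)) (trans eq (eval-linear a b _))))

  cubic-injective : ∀ {a b c} → ¬ (a ≈ 0#) → ∀ {x y} → eval (cubic a b c) x ≈ eval (cubic a b c) y → x ≈ y
  cubic-injective {a} {b} {c} a≉0 eq = ∙-cancelʳ c _ _ (cube-injective (*-cancelˡ a≉0 (∙-cancelʳ b _ _
    (trans (sym (eval-cubic a b c _)) (trans eq (eval-cubic a b c _))))))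

  -- fzero selects the linear polynomials.
  Parameters : Set
  Parameters = (Fin (suc q) × Fin q) × Fin n

  -- `punchIn` skips the index of 0, so the q - 1 indices run through the nonzero elements.
  leading : Fin n → Carrier
  leading a = θ (punchIn (θ⁻¹ 0#) a)

  leading-≉0 : ∀ a → ¬ (leading a ≈ 0#)
  leading-≉0 a eq = Fin.punchInᵢ≢i (θ⁻¹ 0#) a (θ-injective (trans eq (sym (θ-θ⁻¹ 0#))))

  leading-injective : ∀ {a a′} → leading a ≈ leading a′ → a ≡ a′
  leading-injective {a} {a′} eq = Fin.punchIn-injective (θ⁻¹ 0#) a a′ (θ-injective eq)

  polynomial : Parameters → Fin 4 → Carrier
  polynomial ((fzero  , b) , a) = linear (leading a) (θ b)
  polynomial ((fsuc c , b) , a) = cubic (leading a) (θ b) (θ c)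

  polynomial-permutes : ∀ u {x y} → eval (polynomial u) x ≈ eval (polynomial u) y → x ≈ y
  polynomial-permutes ((fzero  , b) , a) = linear-injective (leading-≉0 a)
  polynomial-permutes ((fsuc c , b) , a) = cubic-injective (leading-≉0 a)

  -- The cubic coefficient is nonzero exactly for the second family. There it is a; the quadratic
  -- one, 3 a c, then gives c since 3 and a are nonzero, and the constant one gives b.
  polynomial-injective : ∀ u v → (∀ i → polynomial u i ≈ polynomial v i) → u ≡ v
  polynomial-injective ((fzero  , b) , a) ((fzero   , b′) , a′) eq =
    ≡.cong₂ (λ b a → (fzero , b) , a) (θ-injective (eq fzero)) (leading-injective (eq (fsuc fzero)))
  polynomial-injective ((fzero  , b) , a) ((fsuc c′ , b′) , a′) eq =
    ⊥-elim (leading-≉0 a′ (sym (eq (fsuc (fsuc (fsuc fzero))))))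
  polynomial-injective ((fsuc c , b) , a) ((fzero   , b′) , a′) eq =
    ⊥-elim (leading-≉0 a (eq (fsuc (fsuc (fsuc fzero)))))
  polynomial-injective ((fsuc c , b) , a) ((fsuc c′ , b′) , a′) eq
    with leading-injective {a} {a′} (eq (fsuc (fsuc (fsuc fzero))))
  ... | ≡.refl with θ-injective {c} {c′} (*-cancelˡ (leading-≉0 a) (*-cancelˡ 3≉0 (eq (fsuc (fsuc fzero)))))
  ...   | ≡.refl with θ-injective {b} {b′} (∙-cancelʳ _ _ _ (eq fzero))
  ...     | ≡.refl = ≡.refl

  codeword : Parameters → Permutation′ q
  codeword u = induced (eval (polynomial u)) (polynomial-permutes u)

  codeword-distance : ∀ u v → ¬ (u ≡ v) → q ∸ 3 ≤ hamming (codeword u) (codeword v)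
  codeword-distance u v u≢v = hamming-≥ 3 (codeword u) (codeword v) λ r r-injective agree →
    u≢v (polynomial-injective u v (eval-injective (polynomial u) (polynomial v) (θ ∘ r)
      (r-injective ∘ θ-injective)
      (λ i → trans (sym (θ-θ⁻¹ _)) (trans (reflexive (≡.cong θ (agree i))) (θ-θ⁻¹ _)))))

  parameters : Fin (suc q ℕ.* q ℕ.* n) → Parameters
  parameters i with remQuot {suc q ℕ.* q} n i
  ... | j , a = remQuot {suc q} q j , a

  parameters-injective : ∀ {i j} → parameters i ≡ parameters j → i ≡ j
  parameters-injective {i} {j} eq = ≡.trans (≡.sym (recombine i)) (≡.trans (≡.cong combine-all eq) (recombine j))
    where
    combine-all : Parameters → Fin (suc q ℕ.* q ℕ.* n)
    combine-all ((c , b) , a) = combine (combine c b) a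
    recombine : ∀ i → combine-all (parameters i) ≡ i
    recombine i = ≡.trans (≡.cong (λ j → combine j (proj₂ (remQuot {suc q ℕ.* q} n i)))
        (Fin.combine-remQuot {suc q} q (proj₁ (remQuot {suc q ℕ.* q} n i))))
      (Fin.combine-remQuot {suc q ℕ.* q} n i)

  -- `4 ≤ q` makes q - 3 positive, so the distance bound already yields distinctness. For q = 2 the
  -- truncated distance is 0, and six distinct codewords cannot be found among two permutations.
  code : 4 ≤ q → M≥ q (q ∸ 3) (suc q ℕ.* q ℕ.* n)
  code 4≤q = codeword ∘ parameters , λ i j i≢j →
    let distance = codeword-distance (parameters i) (parameters j) (i≢j ∘ parameters-injective)
    in ℕ.≤-trans (ℕ.∸-monoˡ-≤ 3 4≤q) distance , distance

-- Assembly for q = p ^ (e + 1)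

p∣3⇒p≡3 : ∀ {p} → Prime p → p ∣ 3 → p ≡ 3
p∣3⇒p≡3 pr p∣3 with prime⇒irreducible (from-yes (prime? 3)) p∣3
... | inj₁ ≡.refl = ⊥-elim (¬prime[1] pr)
... | inj₂ p≡3    = p≡3

separatedField⇒code : ∀ {p e n-1} → SeparatedField p e (suc (suc n-1)) → Prime p →
  let q = suc (suc n-1) in q ≡ p ℕ.^ suc e → q % 3 ≡ 2 → 4 ≤ q → M≥ q (q ∸ 3) (suc q ℕ.* q ℕ.* suc n-1)
separatedField⇒code {p} {e} {n-1} F pr q≡pᵏ q%3≡2 4≤q = code 4≤q
  where
  open SeparatedField F
  open Conjugates ring isField pr killedBy
    (≡.subst (λ m → PowerIdentity m ring) q≡pᵏ powerIdentity) generator separated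
  open Saturation ring isField
  -- If 3 vanished, p would be 3 and would divide q, against q ≡ 2 mod 3.
  3≉0 : ¬ KilledBy 3 ring
  3≉0 3·1≈0 with p∣3⇒p≡3 pr (·1≈0⇒∣ 3 3·1≈0)
  ... | ≡.refl = ℕ.0≢1+n (≡.trans (≡.sym (≡.trans (≡.cong (_% 3) q≡pᵏ)
        (n∣m⇒m%n≡0 (3 ℕ.^ suc e) 3 (m∣m*n (3 ℕ.^ e))))) q%3≡2)
  open CubicCode ring isField n-1 powerIdentity 3≉0 q%3≡2
    (element ∘ ≡.subst Fin q≡pᵏ)
    (λ eq → ≡.subst-injective q≡pᵏ (element-injective eq))
    (injective⇒surjective n-1 powerIdentity _≟_)

open import Data.Nat using (_+_; _*_)

theorem4 : (q : ℕ) → IsPrimePower q → q % 3 ≡ 2 → 4 ≤ q →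
    M≥ q (q ∸ 3) ((q + 1) * q * (q ∸ 1))
-- The bounds on q and on the exponent leave only these constructors; `e` is one less than the
-- exponent.
theorem4 q@(suc (suc n-1)) (p , suc e , pr , _ , q≡pᵏ) q%3≡2 4≤q =
  ≡.subst (λ m → M≥ q (q ∸ 3) (m * q * (q ∸ 1))) (ℕ.+-comm 1 q)
    (separatedField⇒code (separatedField pr e n-1 (≡.sym q≡pᵏ)) pr q≡pᵏ q%3≡2 4≤q)
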